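{- Fix $p\in(0,1)$, and for each $n\ge 1$ let $G_n\in\mathcal{G}(n,p)$ be an Erdős–Rényi random graph. Then the probability that the domination polynomial $D(G_n,x)$ is unimodal with mode $\lceil \frac{n}{2}\rceil$ tends to $1$ as $n\to\infty$.
   Context: $\mathcal{G}(n,p)$ denotes the Erdős–Rényi random graph model on $n$ vertices: each of the $\binom{n}{2}$ possible edges is present independently with probability $p$. A subset $S$ of the vertices of a finite simple graph $G$ is a dominating set if every vertex of $G$ is either in $S$ or adjacent to a vertex of $S$. Let $d_i(G)$ be the number of dominating sets of $G$ of cardinality $i$. The domination polynomial of $G$ is $D(G,x)=\sum_{i} d_i(G)x^i$, where $0\le i\le |V(G)|$ (coefficients below the domination number are $0$). A real polynomial $a_0+a_1x+\cdots+a_nx^n$ is unimodal with mode $k$ (where $0\le k\le n$) if $a_0\le a_1\le\cdots\le a_k\ge a_{k+1}\ge\cdots\ge a_n$; the mode need not be unique. -}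

module Defs where

open import Data.Nat as ℕ using (ℕ; zero; suc)
import Data.Nat.Properties as ℕ
open import Data.Rational as ℚ using (ℚ; 0ℚ; 1ℚ; ∣_∣; Positive; positive)
import Data.Rational.Properties as ℚ
import Algebra.Properties.CommutativeSemigroup as CommutativeSemigroup
import Algebra.Bundles as Algebra
open import Data.Fin using (Fin; toℕ; inject₁) renaming (suc to fsuc)
import Data.Fin.Properties as Fin
open import Data.Fin.Subset using (Subset; inside; outside; _∈_) renaming (∣_∣ to card)
open import Data.Fin.Subset.Properties using (_∈?_)
open import Data.List using (List; []; _∷_; _++_; map; filter; foldr; length; allFin; cartesianProduct)
import Data.List.Membership.Propositional as List
import Data.List.Membership.DecPropositional as DecMembership
open import Data.Vec using ([]; _∷_)
open import Data.Vec.Functional using (Vector)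
open import Data.Product using (Σ; ∃; ∃-syntax; _×_; _,_; proj₁; proj₂)
open import Data.Product.Properties using (≡-dec)
open import Data.Sum using (_⊎_; inj₁; inj₂; swap)
open import Function using (_∘_)
open import Level using (Level; 0ℓ)
open import Relation.Binary using (Rel; Symmetric)
import Relation.Binary as Binary
open import Relation.Binary.PropositionalEquality
  using (_≡_; _≢_; refl; sym; trans; cong; cong₂; subst; module ≡-Reasoning)
open import Relation.Nullary using (¬_)
open import Relation.Nullary.Decidable using (_×-dec_; _⊎-dec_; _→-dec_; ¬?)
open import Relation.Unary using (Decidable)

-- Real numbers, as Cauchy sequences of rationals.  Two sequences denote
-- the same real when neither is below the other in _<ℝ_; no
-- quotient is formed.

IsCauchy : (ℕ → ℚ) → Set
IsCauchy x = ∀ ε → 0ℚ ℚ.< ε →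
  ∃[ N ] ∀ m n → N ℕ.≤ m → N ℕ.≤ n → ∣ x m ℚ.- x n ∣ ℚ.< ε

record ℝ : Set where
  constructor mkℝ
  field
    seq    : ℕ → ℚ
    cauchy : IsCauchy seq

open ℝ public

infix 4 _<ℝ_

_<ℝ_ : ℝ → ℝ → Set
x <ℝ y = ∃[ δ ] 0ℚ ℚ.< δ × ∃[ N ] ∀ n → N ℕ.≤ n → seq x n ℚ.+ δ ℚ.< seq y n

private
  open CommutativeSemigroup
    (Algebra.CommutativeMonoid.commutativeSemigroup ℚ.+-0-commutativeMonoid)
    using (interchange)

  -‿+-interchange : ∀ a b c d → (a ℚ.+ b) ℚ.- (c ℚ.+ d) ≡ (a ℚ.- c) ℚ.+ (b ℚ.- d)
  -‿+-interchange a b c d =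
    trans (cong (a ℚ.+ b ℚ.+_) (ℚ.neg-distrib-+ c d)) (interchange a b (ℚ.- c) (ℚ.- d))

  telescope : ∀ a b c → a ℚ.- c ≡ (a ℚ.- b) ℚ.+ (b ℚ.- c)
  telescope a b c = begin
    a ℚ.- c                        ≡⟨ cong (a ℚ.+_) (ℚ.+-identityˡ (ℚ.- c)) ⟨
    a ℚ.+ (0ℚ ℚ.- c)               ≡⟨ cong (λ t → a ℚ.+ (t ℚ.- c)) (ℚ.+-inverseˡ b) ⟨
    a ℚ.+ (ℚ.- b ℚ.+ b ℚ.- c)      ≡⟨ cong (a ℚ.+_) (ℚ.+-assoc (ℚ.- b) b (ℚ.- c)) ⟩
    a ℚ.+ (ℚ.- b ℚ.+ (b ℚ.- c))    ≡⟨ ℚ.+-assoc a (ℚ.- b) (b ℚ.- c) ⟨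
    (a ℚ.- b) ℚ.+ (b ℚ.- c) ∎
    where open ≡-Reasoning

  *-distribˡ-- : ∀ a b c → a ℚ.* (b ℚ.- c) ≡ a ℚ.* b ℚ.- a ℚ.* c
  *-distribˡ-- a b c = trans (ℚ.*-distribˡ-+ a b (ℚ.- c))
    (cong (a ℚ.* b ℚ.+_) (sym (ℚ.neg-distribʳ-* a c)))

  *-telescope : ∀ a b c d →
    a ℚ.* b ℚ.- c ℚ.* d ≡ a ℚ.* (b ℚ.- d) ℚ.+ d ℚ.* (a ℚ.- c)
  *-telescope a b c d = begin
    a ℚ.* b ℚ.- c ℚ.* d
      ≡⟨ telescope (a ℚ.* b) (a ℚ.* d) (c ℚ.* d) ⟩
    (a ℚ.* b ℚ.- a ℚ.* d) ℚ.+ (a ℚ.* d ℚ.- c ℚ.* d)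
      ≡⟨ cong₂ (λ s t → (a ℚ.* b ℚ.- a ℚ.* d) ℚ.+ (s ℚ.- t)) (ℚ.*-comm a d) (ℚ.*-comm c d) ⟩
    (a ℚ.* b ℚ.- a ℚ.* d) ℚ.+ (d ℚ.* a ℚ.- d ℚ.* c)
      ≡⟨ cong₂ ℚ._+_ (*-distribˡ-- a b d) (*-distribˡ-- d a c) ⟨
    a ℚ.* (b ℚ.- d) ℚ.+ d ℚ.* (a ℚ.- c) ∎
    where open ≡-Reasoning

  scale : ∀ C ε → 0ℚ ℚ.< C → 0ℚ ℚ.< ε → ∃[ δ ] 0ℚ ℚ.< δ × C ℚ.* δ ≡ ε
  scale C ε 0<C 0<ε = 1/C ℚ.* ε , 0<δ , Cδ≡ε
    where
    instance
      C-pos : Positive C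
      C-pos = positive 0<C
      C-nonZero : ℚ.NonZero C
      C-nonZero = ℚ.pos⇒nonZero C
    1/C = ℚ.1/ C
    instance
      1/C-pos : Positive 1/C
      1/C-pos = ℚ.1/pos⇒pos C
    0<δ : 0ℚ ℚ.< 1/C ℚ.* ε
    0<δ = subst (ℚ._< 1/C ℚ.* ε) (ℚ.*-zeroʳ 1/C) (ℚ.*-monoʳ-<-pos 1/C 0<ε)
    Cδ≡ε : C ℚ.* (1/C ℚ.* ε) ≡ ε
    Cδ≡ε = trans (sym (ℚ.*-assoc C 1/C ε))
             (trans (cong (ℚ._* ε) (ℚ.*-inverseʳ C)) (ℚ.*-identityˡ ε))

  0<1 : 0ℚ ℚ.< 1ℚ
  0<1 = ℚ.positive⁻¹ 1ℚ

  ≤⊔ˡ : ∀ {m n k} → m ℕ.⊔ n ℕ.≤ k → m ℕ.≤ k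
  ≤⊔ˡ {m} {n} = ℕ.≤-trans (ℕ.m≤m⊔n m n)

  ≤⊔ʳ : ∀ {m n k} → m ℕ.⊔ n ℕ.≤ k → n ℕ.≤ k
  ≤⊔ʳ {m} {n} = ℕ.≤-trans (ℕ.m≤n⊔m m n)

  const-cauchy : ∀ q → IsCauchy (λ _ → q)
  const-cauchy q ε 0<ε = 0 , λ _ _ _ _ →
    subst (ℚ._< ε) (sym (cong ∣_∣ (ℚ.+-inverseʳ q))) 0<ε

  +-cauchy : ∀ x y → IsCauchy x → IsCauchy y → IsCauchy (λ n → x n ℚ.+ y n)
  +-cauchy x y cx cy ε 0<ε
    with δ , 0<δ , 2δ≡ε ← scale (1ℚ ℚ.+ 1ℚ) ε (ℚ.positive⁻¹ (1ℚ ℚ.+ 1ℚ)) 0<ε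
    with M , hM ← cx δ 0<δ
    with N , hN ← cy δ 0<δ
    = M ℕ.⊔ N , λ m n p q → begin-strict
      ∣ (x m ℚ.+ y m) ℚ.- (x n ℚ.+ y n) ∣    ≡⟨ cong ∣_∣ (-‿+-interchange (x m) (y m) (x n) (y n)) ⟩
      ∣ (x m ℚ.- x n) ℚ.+ (y m ℚ.- y n) ∣    ≤⟨ ℚ.∣p+q∣≤∣p∣+∣q∣ (x m ℚ.- x n) (y m ℚ.- y n) ⟩
      ∣ x m ℚ.- x n ∣ ℚ.+ ∣ y m ℚ.- y n ∣    <⟨ ℚ.+-mono-< (hM m n (≤⊔ˡ p) (≤⊔ˡ q)) (hN m n (≤⊔ʳ {M} p) (≤⊔ʳ {M} q)) ⟩
      δ ℚ.+ δ                                ≡⟨ cong₂ ℚ._+_ (ℚ.*-identityˡ δ) (ℚ.*-identityˡ δ) ⟨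
      1ℚ ℚ.* δ ℚ.+ 1ℚ ℚ.* δ                  ≡⟨ ℚ.*-distribʳ-+ δ 1ℚ 1ℚ ⟨
      (1ℚ ℚ.+ 1ℚ) ℚ.* δ                      ≡⟨ 2δ≡ε ⟩
      ε ∎
    where
    open ℚ.≤-Reasoning

  neg-cauchy : ∀ x → IsCauchy x → IsCauchy (λ n → ℚ.- x n)
  neg-cauchy x cx ε 0<ε with N , hN ← cx ε 0<ε = N , λ m n p q →
    subst (ℚ._< ε)
      (trans (sym (ℚ.∣-p∣≡∣p∣ (x m ℚ.- x n))) (cong ∣_∣ (ℚ.neg-distrib-+ (x m) (ℚ.- x n))))
      (hN m n p q)

  split : ∀ a b → a ≡ (a ℚ.- b) ℚ.+ b
  split a b = sym (trans (ℚ.+-assoc a (ℚ.- b) b)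
    (trans (cong (a ℚ.+_) (ℚ.+-inverseˡ b)) (ℚ.+-identityʳ a)))

  bounded : ∀ x → IsCauchy x → ∃[ B ] 0ℚ ℚ.< B × ∃[ N ] ∀ n → N ℕ.≤ n → ∣ x n ∣ ℚ.≤ B
  bounded x cx with N , hN ← cx 1ℚ 0<1 =
    1ℚ ℚ.+ ∣ x N ∣
    , ℚ.+-mono-<-≤ 0<1 (ℚ.0≤∣p∣ (x N))
    , N
    , λ n p → begin
        ∣ x n ∣                        ≡⟨ cong ∣_∣ (split (x n) (x N)) ⟩
        ∣ (x n ℚ.- x N) ℚ.+ x N ∣      ≤⟨ ℚ.∣p+q∣≤∣p∣+∣q∣ (x n ℚ.- x N) (x N) ⟩
        ∣ x n ℚ.- x N ∣ ℚ.+ ∣ x N ∣    ≤⟨ ℚ.+-monoˡ-≤ ∣ x N ∣ (ℚ.<⇒≤ (hN n N p ℕ.≤-refl)) ⟩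
        1ℚ ℚ.+ ∣ x N ∣ ∎
    where
    open ℚ.≤-Reasoning

  *-cauchy : ∀ x y → IsCauchy x → IsCauchy y → IsCauchy (λ n → x n ℚ.* y n)
  *-cauchy x y cx cy ε 0<ε
    with A , 0<A , K , hA ← bounded x cx
    with B , 0<B , L , hB ← bounded y cy
    with δ , 0<δ , Cδ≡ε ← scale (A ℚ.+ B) ε (ℚ.+-mono-< 0<A 0<B) 0<ε
    with M , hM ← cx δ 0<δ
    with N , hN ← cy δ 0<δ
    = (K ℕ.⊔ L) ℕ.⊔ (M ℕ.⊔ N) , λ m n p q → begin-strict
      ∣ x m ℚ.* y m ℚ.- x n ℚ.* y n ∣
        ≡⟨ cong ∣_∣ (*-telescope (x m) (y m) (x n) (y n)) ⟩
      ∣ x m ℚ.* (y m ℚ.- y n) ℚ.+ y n ℚ.* (x m ℚ.- x n) ∣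
        ≤⟨ ℚ.∣p+q∣≤∣p∣+∣q∣ (x m ℚ.* (y m ℚ.- y n)) (y n ℚ.* (x m ℚ.- x n)) ⟩
      ∣ x m ℚ.* (y m ℚ.- y n) ∣ ℚ.+ ∣ y n ℚ.* (x m ℚ.- x n) ∣
        <⟨ ℚ.+-mono-<
             (bound (x m) (y m ℚ.- y n) 0<A (hA m (≤⊔ˡ {K} (≤⊔ˡ p))) (hN m n (≤⊔ʳ {M} (≤⊔ʳ {K ℕ.⊔ L} p)) (≤⊔ʳ {M} (≤⊔ʳ {K ℕ.⊔ L} q))))
             (bound (y n) (x m ℚ.- x n) 0<B (hB n (≤⊔ʳ {K} (≤⊔ˡ q))) (hM m n (≤⊔ˡ {M} (≤⊔ʳ {K ℕ.⊔ L} p)) (≤⊔ˡ {M} (≤⊔ʳ {K ℕ.⊔ L} q)))) ⟩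
      A ℚ.* δ ℚ.+ B ℚ.* δ
        ≡⟨ ℚ.*-distribʳ-+ δ A B ⟨
      (A ℚ.+ B) ℚ.* δ
        ≡⟨ Cδ≡ε ⟩
      ε ∎
    where
    open ℚ.≤-Reasoning
    bound : ∀ {C δ} a t → 0ℚ ℚ.< C → ∣ a ∣ ℚ.≤ C → ∣ t ∣ ℚ.< δ → ∣ a ℚ.* t ∣ ℚ.< C ℚ.* δ
    bound {C} {δ} a t 0<C a≤C t<δ = begin-strict
      ∣ a ℚ.* t ∣        ≡⟨ ℚ.∣p*q∣≡∣p∣*∣q∣ a t ⟩
      ∣ a ∣ ℚ.* ∣ t ∣    ≤⟨ ℚ.*-monoʳ-≤-nonNeg ∣ t ∣ {{ℚ.∣-∣-nonNeg t}} a≤C ⟩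
      C ℚ.* ∣ t ∣        <⟨ ℚ.*-monoʳ-<-pos C {{positive 0<C}} t<δ ⟩
      C ℚ.* δ ∎

infixl 6 _+ℝ_ _-ℝ_
infixl 7 _*ℝ_
infixr 8 _^ℝ_

fromℚ : ℚ → ℝ
fromℚ q = mkℝ (λ _ → q) (const-cauchy q)

0ℝ 1ℝ : ℝ
0ℝ = fromℚ 0ℚ
1ℝ = fromℚ 1ℚ

_+ℝ_ _*ℝ_ _-ℝ_ : ℝ → ℝ → ℝ
x +ℝ y = mkℝ (λ n → seq x n ℚ.+ seq y n) (+-cauchy (seq x) (seq y) (cauchy x) (cauchy y))
x *ℝ y = mkℝ (λ n → seq x n ℚ.* seq y n) (*-cauchy (seq x) (seq y) (cauchy x) (cauchy y))
x -ℝ y = mkℝ (λ n → seq x n ℚ.- seq y n) (+-cauchy (seq x) (ℚ.-_ ∘ seq y) (cauchy x) (neg-cauchy (seq y) (cauchy y)))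

_^ℝ_ : ℝ → ℕ → ℝ
x ^ℝ zero  = 1ℝ
x ^ℝ suc k = x *ℝ x ^ℝ k

sumℝ : List ℝ → ℝ
sumℝ = foldr _+ℝ_ 0ℝ

_TendsTo_ : (ℕ → ℝ) → ℝ → Set
a TendsTo l = ∀ ε → 0ℝ <ℝ ε →
  ∃[ N ] ∀ n → N ℕ.≤ n → l -ℝ ε <ℝ a n × a n <ℝ l +ℝ ε

-- The polynomial a₀ + a₁x + ⋯ + aₙxⁿ is given by its coefficient vector c;
-- the entry at inject₁ i is aᵢ and the one at suc i is aᵢ₊₁.

module _ {a ℓ : Level} {A : Set a} (_≤_ : Rel A ℓ) where

  UnimodalWithMode : ∀ {n} → Vector A (suc n) → ℕ → Set ℓ
  UnimodalWithMode {n} c k =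
      k ℕ.≤ n
    × (∀ (i : Fin n) → toℕ i ℕ.< k → c (inject₁ i) ≤ c (fsuc i))
    × (∀ (i : Fin n) → k ℕ.≤ toℕ i → c (fsuc i) ≤ c (inject₁ i))

  unimodalWithMode? : Binary.Decidable _≤_ →
    ∀ {n} k → Decidable (λ (c : Vector A (suc n)) → UnimodalWithMode c k)
  unimodalWithMode? _≤?_ {n} k c =
          k ℕ.≤? n
    ×-dec Fin.all? (λ i → (toℕ i ℕ.<? k) →-dec (c (inject₁ i) ≤? c (fsuc i)))
    ×-dec Fin.all? (λ i → (k ℕ.≤? toℕ i) →-dec (c (fsuc i) ≤? c (inject₁ i)))

record SimpleGraph (n : ℕ) : Set₁ where
  field
    Adj         : Rel (Fin n) 0ℓ
    symmetric   : Symmetric Adj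
    irreflexive : ∀ v → ¬ Adj v v
    adj?        : Binary.Decidable Adj

module _ {n : ℕ} (G : SimpleGraph n) where
  open SimpleGraph G

  Dominating : Subset n → Set
  Dominating S = ∀ v → v ∈ S ⊎ ∃[ u ] u ∈ S × Adj u v

  dominating? : Decidable Dominating
  dominating? S =
    Fin.all? λ v → (v ∈? S) ⊎-dec Fin.any? λ u → (u ∈? S) ×-dec adj? u v

allSubsets : ∀ n → List (Subset n)
allSubsets zero    = [] ∷ []
allSubsets (suc n) = map (inside ∷_) (allSubsets n) ++ map (outside ∷_) (allSubsets n)

#dominatingSets : ∀ {n} → SimpleGraph n → ℕ → ℕ
#dominatingSets {n} G i =
  length (filter (λ S → dominating? G S ×-dec (card S ℕ.≟ i)) (allSubsets n))

-- The coefficients are counts, so they are kept in ℕ, where their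
-- order is decidable.
dominationPolynomial : ∀ {n} → SimpleGraph n → Vector ℕ (suc n)
dominationPolynomial G i = #dominatingSets G (toℕ i)

-- The sample space of 𝒢(n,p), with vertex set Fin n, consists of the edge
-- sets E, that is, the sublists of this duplicate-free list of the pairs
-- (i , j) with i < j.
potentialEdges : ∀ n → List (Fin n × Fin n)
potentialEdges n =
  filter (λ (i , j) → i Fin.<? j) (cartesianProduct (allFin n) (allFin n))

sublists : {A : Set} → List A → List (List A)
sublists []       = [] ∷ []
sublists (x ∷ xs) = map (x ∷_) (sublists xs) ++ sublists xs

module _ {n : ℕ} where
  open DecMembership (≡-dec (Fin._≟_ {n}) (Fin._≟_ {n})) using () renaming (_∈?_ to _∈ₗ?_)

  fromEdges : List (Fin n × Fin n) → SimpleGraph n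
  fromEdges E = record
    { Adj         = λ u v → u ≢ v × ((u , v) List.∈ E ⊎ (v , u) List.∈ E)
    ; symmetric   = λ (u≢v , e) → u≢v ∘ sym , swap e
    ; irreflexive = λ v (v≢v , _) → v≢v refl
    ; adj?        = λ u v →
        ¬? (u Fin.≟ v) ×-dec (((u , v) ∈ₗ? E) ⊎-dec ((v , u) ∈ₗ? E))
    }

-- Every potential edge is present independently with probability p, so an
-- edge set E has probability p^|E| (1-p)^(n(n-1)/2 - |E|).
edgeSetProbability : ∀ n → ℝ → List (Fin n × Fin n) → ℝ
edgeSetProbability n p E =
  p ^ℝ length E *ℝ (1ℝ -ℝ p) ^ℝ (length (potentialEdges n) ℕ.∸ length E)

Pr[𝒢_,_] : ∀ n → ℝ → {P : SimpleGraph n → Set} → Decidable P → ℝ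
Pr[𝒢 n , p ] P? =
  sumℝ (map (edgeSetProbability n p)
            (filter (P? ∘ fromEdges) (sublists (potentialEdges n))))

DominationUnimodalWithMode : ∀ {n} → ℕ → SimpleGraph n → Set
DominationUnimodalWithMode k G = UnimodalWithMode ℕ._≤_ (dominationPolynomial G) k

dominationUnimodalWithMode? : ∀ {n} k → Decidable (DominationUnimodalWithMode {n} k)
dominationUnimodalWithMode? k G =
  unimodalWithMode? ℕ._≤_ ℕ._≤?_ k (dominationPolynomial G)

{-# OPTIONS --safe #-}

-- Double counting the pairs S ⊂ S ∪ {v} shows that dᵢ ≤ dᵢ₊₁ for 2i < n in
-- every graph.  For 2i ≥ n at most 2^(-|N[v]|) C(n,i) sets of size i miss the
-- closed neighbourhood N[v]; hence if n² ≤ 2^|N[v]| for all v, then at most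
-- C(n,i) / n sets of size i are not dominating, which is at most the drop
-- from C(n,i) to C(n,i+1), so that dᵢ₊₁ ≤ dᵢ.  By Markov's inequality for
-- n² Σᵥ 2^(-deg v), whose expectation is n³ (1 − p/2)ⁿ⁻¹, this degree
-- condition fails with probability tending to 0.  The real p enters only
-- through its rational approximations, for which the estimate is uniform.

module Submission where

open import Defs
open import Data.Nat using (⌈_/2⌉)

open import Algebra.Bundles using (CommutativeRing)
open import Data.Bool using (Bool; true; false; if_then_else_; not; _∧_)
open import Data.Fin using (Fin; toℕ; inject₁; punchIn) renaming (zero to fzero; suc to fsuc; _<_ to _<ᶠ_)
import Data.Fin.Properties as Fin
open import Data.Fin.Subset using (Subset; inside; outside; _∈_; _∉_; _⊆_; ∁) renaming (∣_∣ to card; _-_ to _∖_)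
open import Data.Fin.Subset.Properties
  using (_∈?_; ∣∁p∣≡n∸∣p∣; ∣p∣≤n; out⊆; s⊆s; x∈p∧x≢y⇒x∈p-y; x∈p⇒∣p-x∣<∣p∣)
import Data.Integer as ℤ
import Data.Integer.Properties as ℤ
open import Data.List using (List; []; _∷_; _++_; map; filter; length; foldr; allFin; cartesianProduct; lookup)
import Data.List.Membership.Propositional as List
open import Data.List.Membership.Propositional.Properties
  using (∈-allFin; ∈-++⁻; ∈-map⁻; ∈-filter⁺; ∈-filter⁻; ∈-cartesianProduct⁺)
import Data.List.Properties as List
open import Data.List.Relation.Binary.Sublist.Propositional
  using () renaming (_⊆_ to _⊆ₗ_; [] to []ₗ; _∷ʳ_ to _∷ʳₗ_; _∷_ to _∷ₗ_)
open import Data.List.Relation.Binary.Sublist.Propositional.Properties using (All-resp-⊆; length-mono-≤)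
open import Data.List.Relation.Unary.All as All using (All; []; _∷_)
open import Data.List.Relation.Unary.All.Properties using (all-filter)
open import Data.List.Relation.Unary.AllPairs using (AllPairs; []; _∷_)
open import Data.List.Relation.Unary.Any as Any using (here; there)
open import Data.List.Relation.Unary.Any.Properties using (lookup-index)
open import Data.List.Relation.Unary.Unique.Propositional using (Unique)
import Data.List.Relation.Unary.Unique.Propositional.Properties as Unique
open import Data.Nat as ℕ using (ℕ; zero; suc)
import Data.Nat.DivMod as ℕ
import Data.Nat.Properties as ℕ
open import Data.Product using (_×_; _,_; ∃-syntax)
open import Data.Sum using (_⊎_; inj₁; inj₂)
open import Data.Unit using (⊤; tt)
open import Data.Vec using ([]; _∷_; here; there; tabulate)
open import Data.Vec.Properties using (lookup⇒[]=; []=⇒lookup; lookup∘tabulate)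
open import Function using (_∘_)
open import Relation.Binary.PropositionalEquality
open import Relation.Nullary using (Dec; yes; no; does; ¬_; contradiction)
open import Relation.Nullary.Decidable using (_×-dec_; _⊎-dec_; dec-true)
open import Relation.Unary using (Decidable)

-- The tight place is the middle: (i + 1)(C(n,i) - C(n,i+1)) = (2i + 1 - n) C(n,i), which for 2i = n
-- is a single C(n,i). The drop is then only the fraction 1/(i + 1) of C(n,i), so the non-dominating
-- sets may take up no more than about 1/n of the i-sets; the union bound over the n vertices costs
-- another factor n. Hence n².
--
-- The variable 2^(-deg v) replaces a deviation bound for binomial distributions because it is a
-- product over the edges at v: its expectation is exactly a power of 1 - p + p/2, obtained by
-- induction over the list of potential edges with ring identities alone.
--
-- An inequality `_<ℝ_` demands one rational gap valid at all late indices. A rational δ with 0 < δ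
-- < p bounds all late terms of p from below, so (1 - δ/2)ⁿ⁻¹ controls the error at all those
-- indices at once, and the threshold for n can be fixed before the index.

module _ where
  open import Data.Nat
  open import Data.Nat.Combinatorics using (_C_; nC1≡n; k>n⇒nCk≡0; nCk+nC[k+1]≡[n+1]C[k+1])
  open import Data.Nat.ListAction using (sum)
  open import Data.Nat.ListAction.Properties using (sum-++)
  open import Data.Nat.Properties
  open import Data.Nat.Solver using (module +-*-Solver)

  -- Counting subsets by size

  indicator : Bool → ℕ
  indicator b = if b then 1 else 0

  indicator-not : ∀ b → indicator b + indicator (not b) ≡ 1
  indicator-not true  = refl
  indicator-not false = refl

  indicator-mono : {P Q : Set} (P? : Dec P) (Q? : Dec Q) → (P → Q) → indicator (does P?) ≤ indicator (does Q?)
  indicator-mono (no _)  _        _   = z≤n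
  indicator-mono (yes p) (yes _)  _   = ≤-refl
  indicator-mono (yes p) (no ¬q)  P⇒Q = contradiction (P⇒Q p) ¬q

  -- The recursion copies Pascal's rule: a set of size i + 1 either contains the first element or
  -- does not. Counts of sets therefore split by computation, just as binomial coefficients do.
  slice : ∀ {n} → (Subset n → ℕ) → ℕ → ℕ
  slice {zero}  f zero    = f []
  slice {zero}  f (suc i) = 0
  slice {suc n} f zero    = slice (f ∘ (outside ∷_)) zero
  slice {suc n} f (suc i) = slice (f ∘ (inside ∷_)) i + slice (f ∘ (outside ∷_)) (suc i)

  slice-mono : ∀ {n} {f g : Subset n → ℕ} → (∀ S → f S ≤ g S) → ∀ i → slice f i ≤ slice g i
  slice-mono {zero}  f≤g zero    = f≤g []
  slice-mono {zero}  f≤g (suc i) = z≤n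
  slice-mono {suc n} f≤g zero    = slice-mono (f≤g ∘ (outside ∷_)) zero
  slice-mono {suc n} f≤g (suc i) =
    +-mono-≤ (slice-mono (f≤g ∘ (inside ∷_)) i) (slice-mono (f≤g ∘ (outside ∷_)) (suc i))

  slice-cong : ∀ {n} {f g : Subset n → ℕ} → (∀ S → f S ≡ g S) → ∀ i → slice f i ≡ slice g i
  slice-cong f≡g i =
    ≤-antisym (slice-mono (≤-reflexive ∘ f≡g) i) (slice-mono (≤-reflexive ∘ sym ∘ f≡g) i)

  slice-0 : ∀ n i → slice {n} (λ _ → 0) i ≡ 0
  slice-0 zero    zero    = refl
  slice-0 zero    (suc i) = refl
  slice-0 (suc n) zero    = slice-0 n zero
  slice-0 (suc n) (suc i) = cong₂ _+_ (slice-0 n i) (slice-0 n (suc i))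

  slice-+ : ∀ {n} (f g : Subset n → ℕ) i → slice (λ S → f S + g S) i ≡ slice f i + slice g i
  slice-+ {zero}  f g zero    = refl
  slice-+ {zero}  f g (suc i) = refl
  slice-+ {suc n} f g zero    = slice-+ (f ∘ (outside ∷_)) (g ∘ (outside ∷_)) zero
  slice-+ {suc n} f g (suc i) = trans
    (cong₂ _+_ (slice-+ (f ∘ (inside ∷_)) (g ∘ (inside ∷_)) i)
               (slice-+ (f ∘ (outside ∷_)) (g ∘ (outside ∷_)) (suc i)))
    (solve 4 (λ a b c d → (a :+ b) :+ (c :+ d) := (a :+ c) :+ (b :+ d)) refl
       (slice (f ∘ (inside ∷_)) i) (slice (g ∘ (inside ∷_)) i)
       (slice (f ∘ (outside ∷_)) (suc i)) (slice (g ∘ (outside ∷_)) (suc i)))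
    where open +-*-Solver

  slice-sum : ∀ {n} {A : Set} (g : A → Subset n → ℕ) us i →
    slice (λ S → sum (map (λ u → g u S) us)) i ≡ sum (map (λ u → slice (g u) i) us)
  slice-sum {n} g []       i = slice-0 n i
  slice-sum     g (u ∷ us) i =
    trans (slice-+ (g u) (λ S → sum (map (λ u → g u S) us)) i) (cong (slice (g u) i +_) (slice-sum g us i))

  slice-1 : ∀ n i → slice {n} (λ _ → 1) i ≡ n C i
  slice-1 zero    zero    = refl
  slice-1 zero    (suc i) = refl
  slice-1 (suc n) zero    = slice-1 n zero
  slice-1 (suc n) (suc i) =
    trans (cong₂ _+_ (slice-1 n i) (slice-1 n (suc i))) (nCk+nC[k+1]≡[n+1]C[k+1] n i)

  private
    -- The Boolean test reduces together with `card` on `inside ∷ S`, so `sum-onSlice` needs no case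
    -- distinction on equality of sizes.
    onSlice : ∀ {n} → ℕ → (Subset n → ℕ) → Subset n → ℕ
    onSlice i f S = if card S ≡ᵇ i then f S else 0

    sum-map-0 : {A : Set} (xs : List A) → sum (map (λ _ → 0) xs) ≡ 0
    sum-map-0 []       = refl
    sum-map-0 (x ∷ xs) = sum-map-0 xs

    sum-allSubsets-∷ : ∀ {n} (g : Subset (suc n) → ℕ) →
      sum (map g (allSubsets (suc n))) ≡
      sum (map (g ∘ (inside ∷_)) (allSubsets n)) + sum (map (g ∘ (outside ∷_)) (allSubsets n))
    sum-allSubsets-∷ {n} g = begin
      sum (map g (map (inside ∷_) xs ++ map (outside ∷_) xs))                  ≡⟨ cong sum (List.map-++ g (map (inside ∷_) xs) _) ⟩
      sum (map g (map (inside ∷_) xs) ++ map g (map (outside ∷_) xs))          ≡⟨ sum-++ (map g (map (inside ∷_) xs)) _ ⟩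
      sum (map g (map (inside ∷_) xs)) + sum (map g (map (outside ∷_) xs))     ≡⟨ cong₂ (λ s t → sum s + sum t) (List.map-∘ xs) (List.map-∘ xs) ⟨
      sum (map (g ∘ (inside ∷_)) xs) + sum (map (g ∘ (outside ∷_)) xs) ∎
      where
      open ≡-Reasoning
      xs = allSubsets n

  sum-onSlice : ∀ n (f : Subset n → ℕ) i → sum (map (onSlice i f) (allSubsets n)) ≡ slice f i
  sum-onSlice zero    f zero    = +-identityʳ _
  sum-onSlice zero    f (suc i) = refl
  sum-onSlice (suc n) f zero    = trans (sum-allSubsets-∷ (onSlice 0 f))
    (cong₂ _+_ (sum-map-0 (allSubsets n)) (sum-onSlice n (f ∘ (outside ∷_)) 0))
  sum-onSlice (suc n) f (suc i) = trans (sum-allSubsets-∷ (onSlice (suc i) f))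
    (cong₂ _+_ (sum-onSlice n (f ∘ (inside ∷_)) i) (sum-onSlice n (f ∘ (outside ∷_)) (suc i)))

  length-filter-sum : {A : Set} {P : A → Set} (P? : Decidable P) (xs : List A) →
    length (filter P? xs) ≡ sum (map (indicator ∘ does ∘ P?) xs)
  length-filter-sum P? []       = refl
  length-filter-sum P? (x ∷ xs) with does (P? x)
  ... | true  = cong suc (length-filter-sum P? xs)
  ... | false = length-filter-sum P? xs

  module _ {n : ℕ} (G : SimpleGraph n) where

    #dominatingSets-slice : ∀ i →
      #dominatingSets G i ≡ slice (indicator ∘ does ∘ dominating? G) i
    #dominatingSets-slice i = begin
      length (filter P? (allSubsets n))                 ≡⟨ length-filter-sum P? (allSubsets n) ⟩
      sum (map (indicator ∘ does ∘ P?) (allSubsets n))  ≡⟨ cong sum (List.map-cong indicator-∧ (allSubsets n)) ⟩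
      sum (map (onSlice i f) (allSubsets n))            ≡⟨ sum-onSlice n f i ⟩
      slice f i ∎
      where
      open ≡-Reasoning
      f = indicator ∘ does ∘ dominating? G
      P? = λ S → dominating? G S ×-dec (card S ℕ.≟ i)
      indicator-∧ : ∀ S → indicator (does (P? S)) ≡ onSlice i f S
      indicator-∧ S with does (dominating? G S) | card S ≡ᵇ i
      ... | true  | true  = refl
      ... | true  | false = refl
      ... | false | true  = refl
      ... | false | false = refl

  -- Each set of size i has n − i = k supersets of size i + 1, and each set of
  -- size i + 1 has i + 1 subsets of size i.
  slice-⊆-mono : ∀ n (f : Subset n → ℕ) → (∀ {S T} → S ⊆ T → f S ≤ f T) →
    ∀ i k → i + k ≡ n → k * slice f i ≤ suc i * slice f (suc i)
  slice-⊆-mono n f mono i zero _ = z≤n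
  slice-⊆-mono zero f mono zero (suc k) ()
  slice-⊆-mono zero f mono (suc i) (suc k) ()
  slice-⊆-mono (suc n) f mono zero (suc k) refl = begin
    slice fₒ 0 + k * slice fₒ 0              ≤⟨ +-mono-≤ (slice-mono {f = fₒ} {fᵢ} (λ S → mono {outside ∷ S} {inside ∷ S} (out⊆ λ x → x)) 0)
                                                          (slice-⊆-mono k fₒ (mono ∘ s⊆s) 0 k refl) ⟩
    slice fᵢ 0 + 1 * slice fₒ 1              ≡⟨ solve 2 (λ a b → a :+ con 1 :* b := con 1 :* (a :+ b)) refl (slice fᵢ 0) (slice fₒ 1) ⟩
    1 * (slice fᵢ 0 + slice fₒ 1) ∎
    where
    open ≤-Reasoning
    open +-*-Solver
    fᵢ = f ∘ (inside ∷_)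
    fₒ = f ∘ (outside ∷_)
  slice-⊆-mono (suc n) f mono (suc i) (suc k) eq = begin
    suc k * (slice fᵢ i + slice fₒ (suc i))
      ≡⟨ solve 3 (λ k a b → (con 1 :+ k) :* (a :+ b) := (con 1 :+ k) :* a :+ k :* b :+ b) refl k (slice fᵢ i) (slice fₒ (suc i)) ⟩
    suc k * slice fᵢ i + k * slice fₒ (suc i) + slice fₒ (suc i)
      -- The induction hypotheses cover k + 1 copies of the first sum but only k of the second. The
      -- left-over copy is bounded by adding the first element to each set that lacks it, which
      -- raises the coefficient of `slice fᵢ (suc i)` from i + 1 to i + 2.
      ≤⟨ +-mono-≤ (+-mono-≤
           (slice-⊆-mono n fᵢ (mono ∘ s⊆s) i (suc k) (suc-injective eq))
           (slice-⊆-mono n fₒ (mono ∘ s⊆s) (suc i) k (trans (sym (+-suc i k)) (suc-injective eq))))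
           (slice-mono {f = fₒ} {fᵢ} (λ S → mono {outside ∷ S} {inside ∷ S} (out⊆ λ x → x)) (suc i)) ⟩
    suc i * slice fᵢ (suc i) + suc (suc i) * slice fₒ (suc (suc i)) + slice fᵢ (suc i)
      ≡⟨ solve 3 (λ i a b → (con 1 :+ i) :* a :+ (con 2 :+ i) :* b :+ a := (con 2 :+ i) :* (a :+ b)) refl i (slice fᵢ (suc i)) (slice fₒ (suc (suc i))) ⟩
    suc (suc i) * (slice fᵢ (suc i) + slice fₒ (suc (suc i))) ∎
    where
    open ≤-Reasoning
    open +-*-Solver
    fᵢ = f ∘ (inside ∷_)
    fₒ = f ∘ (outside ∷_)

  -- Binomial coefficients past the middle

  C-absorb : ∀ n i k → i + k ≡ n → suc i * (n C suc i) ≡ k * (n C i)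
  -- Here i = n, so C(n,i+1) vanishes. Throughout, `k` is n - i, kept as an argument so that no
  -- truncated subtraction occurs.
  C-absorb n i zero eq =
    trans (cong (suc i *_) (k>n⇒nCk≡0 {n} (≤-reflexive (cong suc (trans (sym eq) (+-identityʳ i)))))) (*-zeroʳ (suc i))
  C-absorb n zero (suc k) refl =
    trans (*-identityˡ _) (trans (nC1≡n n) (sym (*-identityʳ n)))
  C-absorb (suc n) (suc i) (suc k) eq = begin
    suc (suc i) * (suc n C suc (suc i))               ≡⟨ cong (suc (suc i) *_) (nCk+nC[k+1]≡[n+1]C[k+1] n (suc i)) ⟨
    suc (suc i) * (b + c)                             ≡⟨ solve 3 (λ i b c → (con 2 :+ i) :* (b :+ c) := b :+ (con 1 :+ i) :* b :+ (con 2 :+ i) :* c) refl i b c ⟩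
    b + suc i * b + suc (suc i) * c                   ≡⟨ cong₂ (λ s t → b + s + t) (C-absorb n i (suc k) (suc-injective eq)) (C-absorb n (suc i) k (trans (sym (+-suc i k)) (suc-injective eq))) ⟩
    b + suc k * a + k * b                             ≡⟨ solve 3 (λ k a b → b :+ (con 1 :+ k) :* a :+ k :* b := (con 1 :+ k) :* (a :+ b)) refl k a b ⟩
    suc k * (a + b)                                   ≡⟨ cong (suc k *_) (nCk+nC[k+1]≡[n+1]C[k+1] n i) ⟩
    suc k * (suc n C suc i) ∎
    where
    open ≡-Reasoning
    open +-*-Solver
    a = n C i
    b = n C suc i
    c = n C suc (suc i)

  -- For i < n the ratio C(n,i+1) / C(n,i) is (n - i) / (i + 1) by `C-absorb`, and the hypothesis
  -- makes it at most 1.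
  C-decreasing : ∀ n i → n ≤ suc (i + i) → n C suc i ≤ n C i
  C-decreasing n i n≤2i+1 with <-≤-connex n (suc i)
  ... | inj₁ n<1+i = ≤-trans (≤-reflexive (k>n⇒nCk≡0 n<1+i)) z≤n
  ... | inj₂ i<n with k , refl ← m≤n⇒∃[o]m+o≡n (<⇒≤ i<n) = *-cancelˡ-≤ (suc i) (begin
    suc i * (n C suc i)  ≡⟨ C-absorb n i k refl ⟩
    k * (n C i)          ≤⟨ *-monoˡ-≤ (n C i) (+-cancelˡ-≤ i k (suc i) (≤-trans n≤2i+1 (≤-reflexive (sym (+-suc i i))))) ⟩
    suc i * (n C i) ∎)
    where open ≤-Reasoning

  -- Pascal's rule splits the right side into C(n,i-1) + C(n,i), and past the middle the first term
  -- is at least the second. The hypothesis excludes i = 0.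
  2*C≤C : ∀ n i → n < i + i → 2 * (n C i) ≤ suc n C i
  2*C≤C n (suc i) n<2i = begin
    n C suc i + (n C suc i + 0)  ≡⟨ cong (n C suc i +_) (+-identityʳ _) ⟩
    n C suc i + n C suc i        ≤⟨ +-monoˡ-≤ (n C suc i) (C-decreasing n i (≤-trans (ℕ.s≤s⁻¹ n<2i) (≤-reflexive (+-suc i i)))) ⟩
    n C i + n C suc i            ≡⟨ nCk+nC[k+1]≡[n+1]C[k+1] n i ⟩
    suc n C suc i ∎
    where open ≤-Reasoning

  -- The `t` elements join the ground set one at a time. Each at least doubles the count, since the
  -- ground set has fewer than 2i elements before it joins.
  2^*C≤C : ∀ t r i → t + r ≤ i + i → 2 ^ t * (r C i) ≤ (t + r) C i
  2^*C≤C zero    r i _ = ≤-reflexive (+-identityʳ _)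
  2^*C≤C (suc t) r i t+r<2i = begin
    2 * 2 ^ t * (r C i)    ≡⟨ *-assoc 2 (2 ^ t) (r C i) ⟩
    2 * (2 ^ t * (r C i))  ≤⟨ *-monoʳ-≤ 2 (2^*C≤C t r i (<⇒≤ t+r<2i)) ⟩
    2 * ((t + r) C i)      ≤⟨ 2*C≤C (t + r) i t+r<2i ⟩
    suc (t + r) C i ∎
    where open ≤-Reasoning

  -- Sets disjoint from a given set

  avoids : ∀ {n} → Subset n → Subset n → ℕ
  avoids []      []      = 1
  avoids (t ∷ T) (s ∷ S) = if t ∧ s then 0 else avoids T S

  avoids-disjoint : ∀ {n} (T S : Subset n) → (∀ x → x ∈ S → x ∉ T) → avoids T S ≡ 1
  avoids-disjoint []            []            _        = refl
  avoids-disjoint (outside ∷ T) (s ∷ S)       disjoint = avoids-disjoint T S λ x x∈S x∈T → disjoint (fsuc x) (there x∈S) (there x∈T)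
  avoids-disjoint (inside ∷ T)  (outside ∷ S) disjoint = avoids-disjoint T S λ x x∈S x∈T → disjoint (fsuc x) (there x∈S) (there x∈T)
  avoids-disjoint (inside ∷ T)  (inside ∷ S)  disjoint = contradiction here (disjoint fzero here)

  slice-avoids : ∀ {n} (T : Subset n) i → slice (avoids T) i ≡ card (∁ T) C i
  slice-avoids []            zero    = refl
  slice-avoids []            (suc i) = refl
  slice-avoids (inside ∷ T)  zero    = slice-avoids T zero
  slice-avoids {suc n} (inside ∷ T)  (suc i) = cong₂ _+_ (slice-0 n i) (slice-avoids T (suc i))
  slice-avoids (outside ∷ T) zero    = slice-avoids T zero
  slice-avoids (outside ∷ T) (suc i) =
    trans (cong₂ _+_ (slice-avoids T i) (slice-avoids T (suc i))) (nCk+nC[k+1]≡[n+1]C[k+1] (card (∁ T)) i)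

  -- The i-sets that miss `T` are the i-sets of its complement; putting the elements of `T` back
  -- multiplies their number by at least 2^|T|.
  2^*slice-avoids≤ : ∀ {n} (T : Subset n) i → n ≤ i + i → 2 ^ card T * slice (avoids T) i ≤ n C i
  2^*slice-avoids≤ {n} T i n≤2i = begin
    2 ^ card T * slice (avoids T) i   ≡⟨ cong (2 ^ card T *_) (slice-avoids T i) ⟩
    2 ^ card T * (card (∁ T) C i)       ≤⟨ 2^*C≤C (card T) (card (∁ T)) i (≤-trans (≤-reflexive split) n≤2i) ⟩
    (card T + card (∁ T)) C i         ≡⟨ cong (_C i) split ⟩
    n C i ∎
    where
    open ≤-Reasoning
    split : card T + card (∁ T) ≡ n
    split = trans (cong (card T +_) (∣∁p∣≡n∸∣p∣ T)) (m+[n∸m]≡n (∣p∣≤n T))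

  ∈⇒≤sum : {A : Set} (f : A → ℕ) {u : A} {us : List A} → u List.∈ us → f u ≤ sum (map f us)
  ∈⇒≤sum f (here refl)  = m≤m+n _ _
  ∈⇒≤sum f (there u∈us) = ≤-trans (∈⇒≤sum f u∈us) (m≤n+m _ _)

  sum-map-≤ : {A : Set} (f : A → ℕ) (m b : ℕ) (us : List A) → (∀ u → m * f u ≤ b) →
    m * sum (map f us) ≤ length us * b
  sum-map-≤ f m b []       _  = ≤-reflexive (*-zeroʳ m)
  sum-map-≤ f m b (u ∷ us) f≤ =
    ≤-trans (≤-reflexive (*-distribˡ-+ m (f u) _)) (+-mono-≤ (f≤ u) (sum-map-≤ f m b us f≤))

  -- Monotonicity of the coefficients on either side of n/2

  module _ {n : ℕ} (G : SimpleGraph n) where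
    open SimpleGraph G

    closedNeighbourhood : Fin n → Subset n
    closedNeighbourhood v = tabulate λ u → does ((u Fin.≟ v) ⊎-dec adj? u v)

    ∈-closedNeighbourhood⁺ : ∀ {u v} → u ≡ v ⊎ Adj u v → u ∈ closedNeighbourhood v
    ∈-closedNeighbourhood⁺ {u} {v} uv =
      lookup⇒[]= u _ (trans (lookup∘tabulate _ u) (dec-true ((u Fin.≟ v) ⊎-dec adj? u v) uv))

    ∈-closedNeighbourhood⁻ : ∀ {u v} → u ∈ closedNeighbourhood v → u ≡ v ⊎ Adj u v
    ∈-closedNeighbourhood⁻ {u} {v} u∈N with (u Fin.≟ v) ⊎-dec adj? u v in eq
    ... | yes uv = uv
    ... | no _ with () ← trans (sym ([]=⇒lookup u∈N)) (trans (lookup∘tabulate _ u) (cong does eq))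

    private
      dom nondom : Subset n → ℕ
      dom    = indicator ∘ does ∘ dominating? G
      nondom = indicator ∘ not ∘ does ∘ dominating? G

    dominating-⊆ : ∀ {S T} → S ⊆ T → Dominating G S → Dominating G T
    dominating-⊆ S⊆T d v with d v
    ... | inj₁ v∈S             = inj₁ (S⊆T v∈S)
    ... | inj₂ (u , u∈S , adj) = inj₂ (u , S⊆T u∈S , adj)

    dom-⊆ : ∀ {S T} → S ⊆ T → dom S ≤ dom T
    dom-⊆ {S} {T} S⊆T = indicator-mono (dominating? G S) (dominating? G T) (dominating-⊆ S⊆T)

    #dominatingSets-increasing : ∀ i → suc (i + i) ≤ n → #dominatingSets G i ≤ #dominatingSets G (suc i)
    #dominatingSets-increasing i 2i+1≤n
      with k , eq ← m≤n⇒∃[o]m+o≡n (≤-trans (m≤n⇒m≤1+n (m≤m+n i i)) 2i+1≤n)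
      rewrite #dominatingSets-slice G i | #dominatingSets-slice G (suc i)
      = *-cancelˡ-≤ (suc i) (begin
        -- Cancelling i in 2i + 1 ≤ n = i + k gives i + 1 ≤ k.
        suc i * slice dom i        ≤⟨ *-monoˡ-≤ (slice dom i) (+-cancelˡ-≤ i (suc i) k
                                        (≤-trans (≤-reflexive (+-suc i i)) (≤-trans 2i+1≤n (≤-reflexive (sym eq))))) ⟩
        k * slice dom i            ≤⟨ slice-⊆-mono n dom dom-⊆ i k eq ⟩
        suc i * slice dom (suc i) ∎)
      where open ≤-Reasoning

    -- The union bound: a set that leaves `v` undominated contains no vertex of the closed
    -- neighbourhood of `v`, so the summand at `v` is already 1.
    nondom≤sum-avoids : ∀ S → nondom S ≤ sum (map (λ v → avoids (closedNeighbourhood v) S) (allFin n))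
    nondom≤sum-avoids S = bound (dominating? G S)
      where
      bound : (d? : Dec (Dominating G S)) →
        indicator (not (does d?)) ≤ sum (map (λ v → avoids (closedNeighbourhood v) S) (allFin n))
      bound (yes _) = z≤n
      bound (no ¬d) with v , ¬dv ← Fin.¬∀⟶∃¬ n _ (λ v → (v ∈? S) ⊎-dec Fin.any? λ u → (u ∈? S) ×-dec adj? u v) ¬d =
        ≤-trans (≤-reflexive (sym (avoids-disjoint (closedNeighbourhood v) S disjoint)))
                (∈⇒≤sum (λ v → avoids (closedNeighbourhood v) S) (∈-allFin v))
        where
        disjoint : ∀ x → x ∈ S → x ∉ closedNeighbourhood v
        disjoint x x∈S x∈N with ∈-closedNeighbourhood⁻ x∈N
        ... | inj₁ refl = ¬dv (inj₁ x∈S)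
        ... | inj₂ adj  = ¬dv (inj₂ (x , x∈S , adj))

    module _ (large : ∀ v → n * n ≤ 2 ^ card (closedNeighbourhood v)) where

      -- The sum over the n vertices uses up one of the two factors n supplied by `large`; the other
      -- one remains.
      n*nondom≤C : .{{NonZero n}} → ∀ i → n ≤ i + i → n * slice nondom i ≤ n C i
      n*nondom≤C i n≤2i = *-cancelˡ-≤ n (begin
        n * (n * slice nondom i)                                                   ≡⟨ *-assoc n n _ ⟨
        n * n * slice nondom i                                                     ≤⟨ *-monoʳ-≤ (n * n) (slice-mono nondom≤sum-avoids i) ⟩
        n * n * slice (λ S → sum (map (λ v → avoids (closedNeighbourhood v) S) (allFin n))) i
          ≡⟨ cong (n * n *_) (slice-sum (avoids ∘ closedNeighbourhood) (allFin n) i) ⟩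
        n * n * sum (map (λ v → slice (avoids (closedNeighbourhood v)) i) (allFin n))
          ≤⟨ sum-map-≤ (λ v → slice (avoids (closedNeighbourhood v)) i) (n * n) (n C i) (allFin n) (λ v →
               ≤-trans (*-monoˡ-≤ (slice (avoids (closedNeighbourhood v)) i) (large v))
                       (2^*slice-avoids≤ (closedNeighbourhood v) i n≤2i)) ⟩
        length (allFin n) * (n C i)                                                  ≡⟨ cong (_* (n C i)) (List.length-tabulate {n = n} (λ x → x)) ⟩
        n * (n C i) ∎)
        where open ≤-Reasoning

      -- Both sides are multiplied by i + 1 and increased by n times the number of non-dominating
      -- i-sets, so that the binomial coefficients can be brought in without subtraction.
      #dominatingSets-decreasing : ∀ i → i < n → n ≤ i + i → #dominatingSets G (suc i) ≤ #dominatingSets G i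
      #dominatingSets-decreasing i i<n n≤2i
        with k , eq ← m≤n⇒∃[o]m+o≡n (<⇒≤ i<n)
        rewrite #dominatingSets-slice G i | #dominatingSets-slice G (suc i)
        = *-cancelˡ-≤ (suc i) (+-cancelʳ-≤ (n * slice nondom i) _ _ (begin
          suc i * slice dom (suc i) + n * slice nondom i
            ≤⟨ +-mono-≤ (*-monoʳ-≤ (suc i) (≤-trans (slice-mono dom≤1 (suc i)) (≤-reflexive (slice-1 n (suc i)))))
                        (n*nondom≤C {{ℕ.>-nonZero (≤-<-trans z≤n i<n)}} i n≤2i) ⟩
          suc i * (n C suc i) + n C i                        ≡⟨ cong (_+ n C i) (C-absorb n i k eq) ⟩
          k * (n C i) + n C i                                ≡⟨ +-comm (k * (n C i)) (n C i) ⟩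
          -- From i + k = n ≤ 2i follows k ≤ i, so the extra C(n,i) that bounds the non-dominating
          -- sets still fits.
          suc k * (n C i)                                    ≤⟨ *-monoˡ-≤ (n C i) (s≤s (+-cancelˡ-≤ i k i (≤-trans (≤-reflexive eq) n≤2i))) ⟩
          suc i * (n C i)                                    ≡⟨ cong (suc i *_) (dom+nondom i) ⟨
          suc i * (slice dom i + slice nondom i)           ≡⟨ *-distribˡ-+ (suc i) (slice dom i) (slice nondom i) ⟩
          suc i * slice dom i + suc i * slice nondom i     ≤⟨ +-monoʳ-≤ (suc i * slice dom i) (*-monoˡ-≤ (slice nondom i) i<n) ⟩
          suc i * slice dom i + n * slice nondom i ∎))
        where
        open ≤-Reasoning
        dom≤1 : ∀ S → dom S ≤ 1
        dom≤1 S = ≤-trans (m≤m+n (dom S) (nondom S)) (≤-reflexive (indicator-not (does (dominating? G S))))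
        dom+nondom : ∀ i → slice dom i + slice nondom i ≡ n C i
        dom+nondom i = trans (sym (slice-+ dom nondom i))
          (trans (slice-cong (indicator-not ∘ does ∘ dominating? G) i) (slice-1 n i))

      large⇒unimodal : DominationUnimodalWithMode ⌈ n /2⌉ G
      large⇒unimodal = ⌈n/2⌉≤n n , up , down
        where
        h = ⌈ n /2⌉
        h+h≤1+n : h + h ≤ suc n
        -- `⌈ n /2⌉` unfolds to `⌊ suc n /2⌋`. Now i < h gives 2i + 2 ≤ n + 1 and h ≤ i gives n ≤
        -- 2i, so the two ranges meet at h for both parities of n.
        h+h≤1+n = ≤-trans (+-monoʳ-≤ h (⌊n/2⌋≤⌈n/2⌉ (suc n))) (≤-reflexive (⌊n/2⌋+⌈n/2⌉≡n (suc n)))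
        n≤h+h : n ≤ h + h
        n≤h+h = ≤-trans (≤-reflexive (sym (⌊n/2⌋+⌈n/2⌉≡n n))) (+-monoˡ-≤ h (⌊n/2⌋≤⌈n/2⌉ n))
        up : ∀ (i : Fin n) → toℕ i < h → dominationPolynomial G (inject₁ i) ≤ dominationPolynomial G (fsuc i)
        up i i<h rewrite Fin.toℕ-inject₁ i = #dominatingSets-increasing (toℕ i) (ℕ.s≤s⁻¹ (begin
          suc (suc (toℕ i + toℕ i))  ≡⟨ cong suc (+-suc (toℕ i) (toℕ i)) ⟨
          suc (toℕ i) + suc (toℕ i)  ≤⟨ +-mono-≤ i<h i<h ⟩
          h + h                      ≤⟨ h+h≤1+n ⟩
          suc n ∎))
          where open ≤-Reasoning
        down : ∀ (i : Fin n) → h ≤ toℕ i → dominationPolynomial G (fsuc i) ≤ dominationPolynomial G (inject₁ i)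
        down i h≤i rewrite Fin.toℕ-inject₁ i =
          #dominatingSets-decreasing (toℕ i) (Fin.toℕ<n i) (≤-trans n≤h+h (+-mono-≤ h≤i h≤i))

  -- Degrees in a set of potential edges

  ∈-sublists⁻ : {A : Set} (L : List A) {E : List A} → E List.∈ sublists L → E ⊆ₗ L
  ∈-sublists⁻ []      (here refl) = []ₗ
  ∈-sublists⁻ (x ∷ L) E∈ with ∈-++⁻ (map (x ∷_) (sublists L)) E∈
  ... | inj₂ E∈L = x ∷ʳₗ ∈-sublists⁻ L E∈L
  ... | inj₁ E∈xL with _ , E∈L , refl ← ∈-map⁻ (x ∷_) E∈xL = refl ∷ₗ ∈-sublists⁻ L E∈L

  AllPairs-resp-⊆ : {A : Set} {R : A → A → Set} {xs ys : List A} → xs ⊆ₗ ys → AllPairs R ys → AllPairs R xs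
  AllPairs-resp-⊆ []ₗ         []       = []
  AllPairs-resp-⊆ (_ ∷ʳₗ p)   (_ ∷ rs) = AllPairs-resp-⊆ p rs
  AllPairs-resp-⊆ (refl ∷ₗ p) (r ∷ rs) = All-resp-⊆ p r ∷ AllPairs-resp-⊆ p rs

  -- Pigeonhole: each entry uses up its image, which is then removed from `T`. `Q` marks where `f`
  -- is injective: `otherEnd` is so only on ordered pairs incident to u.
  length≤card : {A : Set} {Q : A → Set} {n : ℕ} (f : A → Fin n) → (∀ {x y} → Q x → Q y → f x ≡ f y → x ≡ y) →
    ∀ {xs} (T : Subset n) → Unique xs → All Q xs → All (λ x → f x ∈ T) xs → length xs ≤ card T
  length≤card f inj T []         []       []       = z≤n
  length≤card f inj {x ∷ _} T (x∉ ∷ uniq) (qx ∷ qs) (fx∈T ∷ fs∈T) =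
    ≤-trans (s≤s (length≤card f inj (T ∖ f x) uniq qs fs∈T-fx)) (x∈p⇒∣p-x∣<∣p∣ fx∈T)
    where
    fs∈T-fx = All.zipWith (λ (x≢y , qy , fy∈T) → x∈p∧x≢y⇒x∈p-y fy∈T (x≢y ∘ sym ∘ inj qy qx))
                (x∉ , All.zip (qs , fs∈T))

  Ordered : ∀ {n} → Fin n × Fin n → Set
  Ordered (i , j) = i <ᶠ j

  module _ {n : ℕ} where

    potentialEdges-ordered : All Ordered (potentialEdges n)
    potentialEdges-ordered = all-filter _ (cartesianProduct (allFin n) (allFin n))

    potentialEdges-unique : Unique (potentialEdges n)
    potentialEdges-unique = Unique.filter⁺ _ (Unique.cartesianProduct⁺ (Unique.allFin⁺ n) (Unique.allFin⁺ n))

    ∈-potentialEdges⁺ : ∀ {i j : Fin n} → i <ᶠ j → (i , j) List.∈ potentialEdges n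
    ∈-potentialEdges⁺ {i} {j} = ∈-filter⁺ _ (∈-cartesianProduct⁺ (∈-allFin i) (∈-allFin j))

  module _ {n : ℕ} (u : Fin n) where

    Incident : Fin n × Fin n → Set
    Incident (i , j) = u ≡ i ⊎ u ≡ j

    incident? : Decidable Incident
    incident? (i , j) = (u Fin.≟ i) ⊎-dec (u Fin.≟ j)

    degree : List (Fin n × Fin n) → ℕ
    degree E = length (filter incident? E)

    otherEnd : Fin n × Fin n → Fin n
    otherEnd (i , j) = if does (u Fin.≟ i) then j else i

    -- The pair of u and v in the order in which `potentialEdges` lists it. The decision is an
    -- argument so that lemmas can match on it. The resulting `edgeTo` inverts `otherEnd`, between
    -- the vertices other than u and the ordered pairs incident to u.
    orient : ∀ {v} → Dec (u <ᶠ v) → Fin n × Fin n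
    orient {v} (yes _) = u , v
    orient {v} (no _)  = v , u

    edgeTo : Fin n → Fin n × Fin n
    edgeTo v = orient (u Fin.<? v)

    otherEnd-orient : ∀ {v} (u<?v : Dec (u <ᶠ v)) → u ≢ v → otherEnd (orient u<?v) ≡ v
    otherEnd-orient (yes _) _ with u Fin.≟ u
    ... | yes _  = refl
    ... | no u≢u = contradiction refl u≢u
    otherEnd-orient {v} (no _) u≢v with u Fin.≟ v
    ... | yes u≡v = contradiction u≡v u≢v
    ... | no _    = refl

    orient-otherEnd : ∀ {e} (u<?e : Dec (u <ᶠ otherEnd e)) → Incident e → Ordered e → orient u<?e ≡ e
    orient-otherEnd {i , j} u<?e inc i<j with u Fin.≟ i
    orient-otherEnd {i , j} (yes _)   inc         i<j | yes refl = refl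
    orient-otherEnd {i , j} (no i≮j)  inc         i<j | yes refl = contradiction i<j i≮j
    orient-otherEnd {i , j} u<?e      (inj₁ u≡i)  i<j | no u≢i   = contradiction u≡i u≢i
    orient-otherEnd {i , j} (yes u<i) (inj₂ refl) i<j | no u≢i   = contradiction i<j (<-asym u<i)
    orient-otherEnd {i , j} (no _)    (inj₂ refl) i<j | no u≢i   = refl

    orient-Incident : ∀ {v} (u<?v : Dec (u <ᶠ v)) → Incident (orient u<?v)
    orient-Incident (yes _) = inj₁ refl
    orient-Incident (no _)  = inj₂ refl

    orient-Ordered : ∀ {v} (u<?v : Dec (u <ᶠ v)) → u ≢ v → Ordered (orient u<?v)
    orient-Ordered (yes u<v) _   = u<v
    orient-Ordered (no u≮v)  u≢v = ≤∧≢⇒< (≮⇒≥ u≮v) (u≢v ∘ sym ∘ Fin.toℕ-injective)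

    otherEnd-Adj : ∀ {E e} → e List.∈ E → Incident e → Ordered e →
      SimpleGraph.Adj (fromEdges E) (otherEnd e) u
    otherEnd-Adj {e = i , j} e∈E inc i<j with u Fin.≟ i
    otherEnd-Adj {e = i , j} e∈E inc         i<j | yes refl = (λ j≡i → <⇒≢ i<j (cong toℕ (sym j≡i))) , inj₂ e∈E
    otherEnd-Adj {e = i , j} e∈E (inj₁ u≡i)  i<j | no u≢i   = contradiction u≡i u≢i
    otherEnd-Adj {e = i , j} e∈E (inj₂ refl) i<j | no u≢i   = u≢i ∘ sym , inj₁ e∈E

    degree≤closedNeighbourhood : ∀ {E} → E List.∈ sublists (potentialEdges n) →
      degree E ≤ card (closedNeighbourhood (fromEdges E) u)
    degree≤closedNeighbourhood {E} E∈ =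
      length≤card {Q = λ e → e List.∈ E × Incident e × Ordered e} otherEnd otherEnd-injective _
        (Unique.filter⁺ incident? (AllPairs-resp-⊆ E⊆ potentialEdges-unique))
        incident
        (All.map (λ (e∈E , inc , ord) → ∈-closedNeighbourhood⁺ (fromEdges E) (inj₂ (otherEnd-Adj e∈E inc ord))) incident)
      where
      E⊆ = ∈-sublists⁻ (potentialEdges n) E∈
      otherEnd-injective : ∀ {e e′} → e List.∈ E × Incident e × Ordered e → e′ List.∈ E × Incident e′ × Ordered e′ →
        otherEnd e ≡ otherEnd e′ → e ≡ e′
      otherEnd-injective (_ , inc , ord) (_ , inc′ , ord′) eq =
        trans (sym (orient-otherEnd (u Fin.<? _) inc ord)) (trans (cong edgeTo eq) (orient-otherEnd (u Fin.<? _) inc′ ord′))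
      incident : All (λ e → e List.∈ E × Incident e × Ordered e) (filter incident? E)
      incident = All.tabulate λ e∈ → let e∈E , inc = ∈-filter⁻ incident? {xs = E} e∈ in
        e∈E , inc , All.lookup (All-resp-⊆ E⊆ potentialEdges-ordered) e∈E

  -- Each of the m vertices other than u has its own position in the list of incident pairs, since
  -- `otherEnd` recovers the vertex from the pair found there. This m becomes the exponent in the
  -- error term.
  degree-potentialEdges : ∀ {m} (u : Fin (suc m)) → m ≤ degree u (potentialEdges (suc m))
  degree-potentialEdges {m} u = Fin.injective⇒≤ {f = Any.index ∘ edge∈} index-injective
    where
    incidentEdges = filter (incident? u) (potentialEdges (suc m))
    edge : Fin m → Fin (suc m) × Fin (suc m)
    edge k = edgeTo u (punchIn u k)
    u≢ : ∀ k → u ≢ punchIn u k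
    u≢ k = Fin.punchInᵢ≢i u k ∘ sym
    edge∈ : ∀ k → edge k List.∈ incidentEdges
    edge∈ k = ∈-filter⁺ (incident? u) (∈-potentialEdges⁺ (orient-Ordered u (u Fin.<? punchIn u k) (u≢ k))) (orient-Incident u (u Fin.<? punchIn u k))
    index-injective : ∀ {k l} → Any.index (edge∈ k) ≡ Any.index (edge∈ l) → k ≡ l
    index-injective {k} {l} eq = Fin.punchIn-injective u k l (begin
      punchIn u k          ≡⟨ otherEnd-orient u (u Fin.<? _) (u≢ k) ⟨
      otherEnd u (edge k)  ≡⟨ cong (otherEnd u) (trans (lookup-index (edge∈ k))
                                (trans (cong (lookup incidentEdges) eq) (sym (lookup-index (edge∈ l))))) ⟩
      otherEnd u (edge l)  ≡⟨ otherEnd-orient u (u Fin.<? _) (u≢ l) ⟩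
      punchIn u l ∎)
      where open ≡-Reasoning

  -- Searching the finitely many vertices turns the failure of the degree condition into a witness.
  -- Its term n² 2^(-deg u) alone exceeds 1, which is what Markov's inequality asks for.
  ¬unimodal⇒small-degree : ∀ {n} {E} → E List.∈ sublists (potentialEdges n) →
    ¬ DominationUnimodalWithMode ⌈ n /2⌉ (fromEdges E) → ∃[ u ] 2 ^ degree u E < n * n
  ¬unimodal⇒small-degree {n} {E} E∈ ¬uni
    with u , ¬large ← Fin.¬∀⟶∃¬ n _ (λ u → n * n ≤? 2 ^ degree u E) (λ large →
      ¬uni (large⇒unimodal (fromEdges E) λ u → ≤-trans (large u) (^-monoʳ-≤ 2 (degree≤closedNeighbourhood u E∈))))
    = u , ≰⇒> ¬large

open import Data.Rational
open import Data.Rational.Properties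
open import Data.Rational.Solver using (module +-*-Solver)
import Data.Rational.Unnormalised as ℚᵘ
import Data.Rational.Unnormalised.Properties as ℚᵘ
open import Algebra.Properties.Semiring.Exp (CommutativeRing.semiring +-*-commutativeRing)
  using (_^_; ^-assocʳ)
open import Algebra.Properties.Semiring.Mult (CommutativeRing.semiring +-*-commutativeRing)
  using (×1-homo-*) renaming (_×_ to _·_)
open +-*-Solver

-- Rational arithmetic

*-monoˡ-≤ : ∀ {r p q} → 0ℚ ≤ r → p ≤ q → r * p ≤ r * q
*-monoˡ-≤ {r} 0≤r = *-monoˡ-≤-nonNeg r {{nonNegative 0≤r}}

*-monoʳ-≤ : ∀ {r p q} → 0ℚ ≤ r → p ≤ q → p * r ≤ q * r
*-monoʳ-≤ {r} 0≤r = *-monoʳ-≤-nonNeg r {{nonNegative 0≤r}}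

*-mono-≤ : ∀ {p q r s} → 0ℚ ≤ q → 0ℚ ≤ r → p ≤ q → r ≤ s → p * r ≤ q * s
*-mono-≤ 0≤q 0≤r p≤q r≤s = ≤-trans (*-monoʳ-≤ 0≤r p≤q) (*-monoˡ-≤ 0≤q r≤s)

0≤+ : ∀ {p q} → 0ℚ ≤ p → 0ℚ ≤ q → 0ℚ ≤ p + q
0≤+ = +-mono-≤

0≤* : ∀ {p q} → 0ℚ ≤ p → 0ℚ ≤ q → 0ℚ ≤ p * q
0≤* {p} {q} 0≤p 0≤q = subst (_≤ p * q) (*-zeroʳ p) (*-monoˡ-≤ 0≤p 0≤q)

0<* : ∀ {p q} → 0ℚ < p → 0ℚ < q → 0ℚ < p * q
0<* {p} {q} 0<p 0<q = subst (_< p * q) (*-zeroʳ p) (*-monoʳ-<-pos p {{positive 0<p}} 0<q)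

0≤1 : 0ℚ ≤ 1ℚ
0≤1 = nonNegative⁻¹ 1ℚ

p≤p+q : ∀ {p q} → 0ℚ ≤ q → p ≤ p + q
p≤p+q {p} {q} 0≤q = subst (_≤ p + q) (+-identityʳ p) (+-monoʳ-≤ p 0≤q)

p≤q+p : ∀ {p q} → 0ℚ ≤ q → p ≤ q + p
p≤q+p {p} {q} 0≤q = subst (_≤ q + p) (+-identityˡ p) (+-monoˡ-≤ p 0≤q)

p≤q⇒0≤q-p : ∀ {p q} → p ≤ q → 0ℚ ≤ q - p
p≤q⇒0≤q-p {p} {q} p≤q = subst (_≤ q - p) (+-inverseʳ p) (+-monoˡ-≤ (- p) p≤q)

0≤^ : ∀ {p} n → 0ℚ ≤ p → 0ℚ ≤ p ^ n
0≤^ zero    _   = 0≤1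
0≤^ (suc n) 0≤p = 0≤* 0≤p (0≤^ n 0≤p)

0<^ : ∀ {p} n → 0ℚ < p → 0ℚ < p ^ n
0<^ zero    _   = positive⁻¹ 1ℚ
0<^ (suc n) 0<p = 0<* 0<p (0<^ n 0<p)

^-monoˡ-≤ : ∀ {p q} n → 0ℚ ≤ p → p ≤ q → p ^ n ≤ q ^ n
^-monoˡ-≤ zero    _   _   = ≤-refl
^-monoˡ-≤ (suc n) 0≤p p≤q =
  *-mono-≤ (≤-trans 0≤p p≤q) (0≤^ n 0≤p) p≤q (^-monoˡ-≤ n 0≤p p≤q)

^-antimonoʳ-≤ : ∀ {p m n} → 0ℚ ≤ p → p ≤ 1ℚ → m ℕ.≤ n → p ^ n ≤ p ^ m
^-antimonoʳ-≤ {p} {n = n} 0≤p p≤1 ℕ.z≤n = p^n≤1 n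
  where
  p^n≤1 : ∀ n → p ^ n ≤ 1ℚ
  p^n≤1 zero    = ≤-refl
  p^n≤1 (suc n) = *-mono-≤ 0≤1 (0≤^ n 0≤p) p≤1 (p^n≤1 n)
^-antimonoʳ-≤ 0≤p p≤1 (ℕ.s≤s m≤n) = *-monoˡ-≤ 0≤p (^-antimonoʳ-≤ 0≤p p≤1 m≤n)

-- As an iterated sum, `ι (suc n)` unfolds to `1ℚ + ι n`, which suits inductions closed by the ring
-- solver.
ι : ℕ → ℚ
ι n = n · 1ℚ

0≤ι : ∀ n → 0ℚ ≤ ι n
0≤ι zero    = ≤-refl
0≤ι (suc n) = 0≤+ 0≤1 (0≤ι n)

ι-mono-≤ : ∀ {m n} → m ℕ.≤ n → ι m ≤ ι n
ι-mono-≤ {n = n} ℕ.z≤n = 0≤ι n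
ι-mono-≤ (ℕ.s≤s m≤n)   = +-monoʳ-≤ 1ℚ (ι-mono-≤ m≤n)

ι-* : ∀ m n → ι (m ℕ.* n) ≡ ι m * ι n
ι-* = ×1-homo-*

toℚᵘ-ι : ∀ n → toℚᵘ (ι n) ℚᵘ.≃ ℚᵘ.mkℚᵘ (ℤ.+ n) 0
toℚᵘ-ι zero    = ℚᵘ.≃-refl
toℚᵘ-ι (suc n) = ℚᵘ.≃-trans (toℚᵘ-homo-+ 1ℚ (ι n)) (ℚᵘ.≃-trans (ℚᵘ.+-congʳ (toℚᵘ 1ℚ) (toℚᵘ-ι n))
  (ℚᵘ.≃-reflexive (cong (λ k → ℚᵘ.mkℚᵘ k 0) (cong (λ k → ℤ.+ 1 ℤ.+ k) (ℤ.*-identityʳ (ℤ.+ n))))))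

archimedean : ∀ q → ∃[ K ] q < ι K
archimedean (mkℚ num d-1 _) = suc ℤ.∣ num ∣ , toℚᵘ-cancel-<
  (ℚᵘ.<-respʳ-≃ (ℚᵘ.≃-sym (toℚᵘ-ι (suc ℤ.∣ num ∣))) (ℚᵘ.*<* num<))
  where
  open ℤ.≤-Reasoning
  num< : num ℤ.* ℤ.+ 1 ℤ.< ℤ.+ suc ℤ.∣ num ∣ ℤ.* ℤ.+ suc d-1
  num< = begin-strict
    num ℤ.* ℤ.+ 1                              ≡⟨ ℤ.*-identityʳ num ⟩
    num                                        ≤⟨ i≤+∣i∣ num ⟩
    ℤ.+ ℤ.∣ num ∣                              <⟨ ℤ.+<+ (ℕ.m≤m*n (suc ℤ.∣ num ∣) (suc d-1)) ⟩
    ℤ.+ (suc ℤ.∣ num ∣ ℕ.* suc d-1)            ≡⟨ ℤ.pos-* (suc ℤ.∣ num ∣) (suc d-1) ⟩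
    ℤ.+ suc ℤ.∣ num ∣ ℤ.* ℤ.+ suc d-1 ∎
    where
    i≤+∣i∣ : ∀ i → i ℤ.≤ ℤ.+ ℤ.∣ i ∣
    i≤+∣i∣ (ℤ.+ n)      = ℤ.≤-refl
    i≤+∣i∣ (ℤ.-[1+ n ]) = ℤ.-≤+

archimedean-* : ∀ a b → 0ℚ < a → ∃[ K ] b < a * ι K
archimedean-* a b 0<a with K , b/a<K ← archimedean (1/_ a {{>-nonZero 0<a}} * b) = K , (begin-strict
  b                ≡⟨ *-identityˡ b ⟨
  1ℚ * b           ≡⟨ cong (_* b) (*-inverseʳ a) ⟨
  a * 1/ a * b     ≡⟨ *-assoc a (1/ a) b ⟩
  a * (1/ a * b)   <⟨ *-monoʳ-<-pos a {{positive 0<a}} b/a<K ⟩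
  a * ι K ∎)
  where
  open ≤-Reasoning
  instance _ = >-nonZero 0<a

-- Random edge sets

Σℚ : {A : Set} → (A → ℚ) → List A → ℚ
Σℚ f = foldr (λ x s → f x + s) 0ℚ

module _ {A : Set} where

  Σℚ-cong : ∀ {f g : A → ℚ} xs → (∀ {x} → x List.∈ xs → f x ≡ g x) → Σℚ f xs ≡ Σℚ g xs
  Σℚ-cong []       _   = refl
  Σℚ-cong (x ∷ xs) f≡g = cong₂ _+_ (f≡g (here refl)) (Σℚ-cong xs (f≡g ∘ there))

  Σℚ-++ : ∀ (f : A → ℚ) xs ys → Σℚ f (xs ++ ys) ≡ Σℚ f xs + Σℚ f ys
  Σℚ-++ f []       ys = sym (+-identityˡ _)
  Σℚ-++ f (x ∷ xs) ys = trans (cong (f x +_) (Σℚ-++ f xs ys)) (sym (+-assoc (f x) _ _))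

  Σℚ-map : ∀ {B : Set} (f : A → ℚ) (g : B → A) xs → Σℚ f (map g xs) ≡ Σℚ (f ∘ g) xs
  Σℚ-map f g []       = refl
  Σℚ-map f g (x ∷ xs) = cong (f (g x) +_) (Σℚ-map f g xs)

  Σℚ-*ˡ : ∀ c (f : A → ℚ) xs → Σℚ (λ x → c * f x) xs ≡ c * Σℚ f xs
  Σℚ-*ˡ c f []       = sym (*-zeroʳ c)
  Σℚ-*ˡ c f (x ∷ xs) = trans (cong (c * f x +_) (Σℚ-*ˡ c f xs)) (sym (*-distribˡ-+ c (f x) _))

  Σℚ-+ : ∀ (f g : A → ℚ) xs → Σℚ (λ x → f x + g x) xs ≡ Σℚ f xs + Σℚ g xs
  Σℚ-+ f g []       = refl
  Σℚ-+ f g (x ∷ xs) = trans (cong (f x + g x +_) (Σℚ-+ f g xs))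
    (solve 4 (λ a b c d → (a :+ b) :+ (c :+ d) := (a :+ c) :+ (b :+ d)) refl (f x) (g x) (Σℚ f xs) (Σℚ g xs))

  Σℚ-0 : ∀ (xs : List A) → Σℚ (λ _ → 0ℚ) xs ≡ 0ℚ
  Σℚ-0 []       = refl
  Σℚ-0 (x ∷ xs) = trans (+-identityˡ _) (Σℚ-0 xs)

module _ {A : Set} where

  Σℚ-swap : ∀ {B : Set} (f : A → B → ℚ) xs ys →
    Σℚ (λ x → Σℚ (f x) ys) xs ≡ Σℚ (λ y → Σℚ (λ x → f x y) xs) ys
  Σℚ-swap f []       ys = sym (Σℚ-0 ys)
  Σℚ-swap f (x ∷ xs) ys = trans (cong (Σℚ (f x) ys +_) (Σℚ-swap f xs ys))
    (sym (Σℚ-+ (f x) (λ y → Σℚ (λ x → f x y) xs) ys))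

  0≤Σℚ : ∀ {f : A → ℚ} → (∀ x → 0ℚ ≤ f x) → ∀ xs → 0ℚ ≤ Σℚ f xs
  0≤Σℚ 0≤f []       = ≤-refl
  0≤Σℚ 0≤f (x ∷ xs) = 0≤+ (0≤f x) (0≤Σℚ 0≤f xs)

  ∈⇒≤Σℚ : ∀ {f : A → ℚ} → (∀ x → 0ℚ ≤ f x) → ∀ {x xs} → x List.∈ xs → f x ≤ Σℚ f xs
  ∈⇒≤Σℚ 0≤f {xs = _ ∷ xs} (here refl) = p≤p+q (0≤Σℚ 0≤f xs)
  ∈⇒≤Σℚ 0≤f {xs = y ∷ xs} (there x∈)  = ≤-trans (∈⇒≤Σℚ 0≤f x∈) (p≤q+p (0≤f y))

  Σℚ≤length* : ∀ {f : A → ℚ} {b} → (∀ x → f x ≤ b) → ∀ xs → Σℚ f xs ≤ ι (length xs) * b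
  Σℚ≤length* {b = b} f≤b []       = ≤-reflexive (sym (*-zeroˡ b))
  Σℚ≤length* {b = b} f≤b (x ∷ xs) = ≤-trans (+-mono-≤ (f≤b x) (Σℚ≤length* f≤b xs))
    (≤-reflexive (solve 2 (λ b l → b :+ l :* b := (con 1ℚ :+ l) :* b) refl b (ι (length xs))))

  module _ {P : A → Set} (P? : Decidable P) {w : A → ℚ} (0≤w : ∀ x → 0ℚ ≤ w x) where

    Σℚ-filter≤ : ∀ xs → Σℚ w (filter P? xs) ≤ Σℚ w xs
    Σℚ-filter≤ []       = ≤-refl
    Σℚ-filter≤ (x ∷ xs) with does (P? x)
    ... | true  = +-monoʳ-≤ (w x) (Σℚ-filter≤ xs)
    ... | false = ≤-trans (Σℚ-filter≤ xs) (p≤q+p (0≤w x))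

    -- Outside `P` each weight is at most its product with `X`. With the total mass on the left, the
    -- mass of the complement is never formed.
    markov : ∀ {X : A → ℚ} → (∀ x → 0ℚ ≤ X x) → ∀ xs → (∀ {x} → x List.∈ xs → ¬ P x → 1ℚ ≤ X x) →
      Σℚ w xs ≤ Σℚ w (filter P? xs) + Σℚ (λ x → w x * X x) xs
    markov 0≤X []       _   = ≤-refl
    markov {X} 0≤X (x ∷ xs) 1≤X with P? x
    ... | yes _ = begin
      w x + Σℚ w xs                      ≤⟨ +-monoʳ-≤ (w x) (markov 0≤X xs (1≤X ∘ there)) ⟩
      w x + (F + M)                      ≤⟨ +-monoʳ-≤ (w x) (+-monoʳ-≤ F (p≤q+p (0≤* (0≤w x) (0≤X x)))) ⟩
      w x + (F + (w x * X x + M))        ≡⟨ +-assoc (w x) F _ ⟨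
      w x + F + (w x * X x + M) ∎
      where
      open ≤-Reasoning
      F = Σℚ w (filter P? xs)
      M = Σℚ (λ x → w x * X x) xs
    ... | no ¬p = begin
      w x + Σℚ w xs                      ≤⟨ +-mono-≤ (subst (_≤ w x * X x) (*-identityʳ (w x)) (*-monoˡ-≤ (0≤w x) (1≤X (here refl) ¬p)))
                                                     (markov 0≤X xs (1≤X ∘ there)) ⟩
      w x * X x + (F + M)                ≡⟨ solve 3 (λ a b c → a :+ (b :+ c) := b :+ (a :+ c)) refl (w x * X x) F M ⟩
      F + (w x * X x + M) ∎
      where
      open ≤-Reasoning
      F = Σℚ w (filter P? xs)
      M = Σℚ (λ x → w x * X x) xs

-- Expectations over random sublists

bernoulliWeight : ℚ → ℕ → ℕ → ℚ
bernoulliWeight q N k = q ^ k * (1ℚ - q) ^ (N ℕ.∸ k)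

0≤bernoulliWeight : ∀ {q} → 0ℚ ≤ q → q ≤ 1ℚ → ∀ N k → 0ℚ ≤ bernoulliWeight q N k
0≤bernoulliWeight 0≤q q≤1 N k = 0≤* (0≤^ k 0≤q) (0≤^ (N ℕ.∸ k) (p≤q⇒0≤q-p q≤1))

-- By independence the expectation of a product over the edges is the product
-- of the expectations.
expectation-^ : {A : Set} {P : A → Set} (P? : Decidable P) (q s : ℚ) (L : List A) →
  Σℚ (λ E → bernoulliWeight q (length L) (length E) * s ^ length (filter P? E)) (sublists L)
    ≡ (1ℚ - q + q * s) ^ length (filter P? L)
expectation-^ P? q s []      = refl
expectation-^ {A} P? q s (x ∷ L) = begin
  Σℚ (f (suc N)) (map (x ∷_) (sublists L) ++ sublists L)
    ≡⟨ Σℚ-++ (f (suc N)) (map (x ∷_) (sublists L)) (sublists L) ⟩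
  Σℚ (f (suc N)) (map (x ∷_) (sublists L)) + Σℚ (f (suc N)) (sublists L)
    ≡⟨ cong₂ _+_ (Σℚ-map (f (suc N)) (x ∷_) (sublists L)) without ⟩
  Σℚ (λ E → f (suc N) (x ∷ E)) (sublists L) + (1ℚ - q) * Σℚ (f N) (sublists L)
    ≡⟨ split ⟩
  (1ℚ - q + q * s) ^ length (filter P? (x ∷ L)) ∎
  where
  open ≡-Reasoning
  N = length L
  f : ℕ → List A → ℚ
  f N E = bernoulliWeight q N (length E) * s ^ length (filter P? E)
  without : Σℚ (f (suc N)) (sublists L) ≡ (1ℚ - q) * Σℚ (f N) (sublists L)
  without = trans
    (Σℚ-cong (sublists L) λ {E} E∈ → trans
      -- Pulling one factor 1 - q out of the truncated exponent requires |E| ≤ N, hence the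
      -- membership of `E` in the list of sublists.
      (cong (λ k → q ^ length E * (1ℚ - q) ^ k * s ^ length (filter P? E))
            (ℕ.+-∸-assoc 1 (length-mono-≤ (∈-sublists⁻ L E∈))))
      (solve 4 (λ a r b c → a :* (r :* b) :* c := r :* (a :* b :* c)) refl
         (q ^ length E) (1ℚ - q) ((1ℚ - q) ^ (N ℕ.∸ length E)) (s ^ length (filter P? E))))
    (Σℚ-*ˡ (1ℚ - q) (f N) (sublists L))
  split : Σℚ (λ E → f (suc N) (x ∷ E)) (sublists L) + (1ℚ - q) * Σℚ (f N) (sublists L)
          ≡ (1ℚ - q + q * s) ^ length (filter P? (x ∷ L))
  -- The new element contributes the factor (1 - q) + q s if `P?` counts it, and (1 - q) + q = 1
  -- otherwise.
  split with does (P? x)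
  ... | true  = begin
    Σℚ (λ E → q * q ^ length E * (1ℚ - q) ^ (N ℕ.∸ length E) * (s * s ^ length (filter P? E))) (sublists L)
      + (1ℚ - q) * Σℚ (f N) (sublists L)
      ≡⟨ cong (_+ (1ℚ - q) * Σℚ (f N) (sublists L)) (trans
           (Σℚ-cong (sublists L) λ {E} _ → solve 5 (λ q a b s c → q :* a :* b :* (s :* c) := q :* s :* (a :* b :* c)) refl
              q (q ^ length E) ((1ℚ - q) ^ (N ℕ.∸ length E)) s (s ^ length (filter P? E)))
           (Σℚ-*ˡ (q * s) (f N) (sublists L))) ⟩
    q * s * Σℚ (f N) (sublists L) + (1ℚ - q) * Σℚ (f N) (sublists L)
      ≡⟨ solve 3 (λ q s a → q :* s :* a :+ (con 1ℚ :- q) :* a := (con 1ℚ :- q :+ q :* s) :* a) refl q s (Σℚ (f N) (sublists L)) ⟩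
    (1ℚ - q + q * s) * Σℚ (f N) (sublists L)
      ≡⟨ cong ((1ℚ - q + q * s) *_) (expectation-^ P? q s L) ⟩
    (1ℚ - q + q * s) * (1ℚ - q + q * s) ^ length (filter P? L) ∎
  ... | false = begin
    Σℚ (λ E → q * q ^ length E * (1ℚ - q) ^ (N ℕ.∸ length E) * s ^ length (filter P? E)) (sublists L)
      + (1ℚ - q) * Σℚ (f N) (sublists L)
      ≡⟨ cong (_+ (1ℚ - q) * Σℚ (f N) (sublists L)) (trans
           (Σℚ-cong (sublists L) λ {E} _ → solve 4 (λ q a b c → q :* a :* b :* c := q :* (a :* b :* c)) refl
              q (q ^ length E) ((1ℚ - q) ^ (N ℕ.∸ length E)) (s ^ length (filter P? E)))
           (Σℚ-*ˡ q (f N) (sublists L))) ⟩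
    q * Σℚ (f N) (sublists L) + (1ℚ - q) * Σℚ (f N) (sublists L)
      ≡⟨ solve 2 (λ q a → q :* a :+ (con 1ℚ :- q) :* a := a) refl q (Σℚ (f N) (sublists L)) ⟩
    Σℚ (f N) (sublists L)
      ≡⟨ expectation-^ P? q s L ⟩
    (1ℚ - q + q * s) ^ length (filter P? L) ∎

-- The case s = 1 of `expectation-^`, where every factor is 1 - q + q = 1.
sum-bernoulliWeight : {A : Set} (q : ℚ) (L : List A) →
  Σℚ (λ E → bernoulliWeight q (length L) (length E)) (sublists L) ≡ 1ℚ
sum-bernoulliWeight {A} q L = begin
  Σℚ (λ E → bernoulliWeight q (length L) (length E)) (sublists L)
    ≡⟨ Σℚ-cong (sublists L) (λ {E} _ → trans (sym (*-identityʳ (w E))) (cong (w E *_) (sym (1^n≡1 (length (filter all? E)))))) ⟩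
  Σℚ (λ E → bernoulliWeight q (length L) (length E) * 1ℚ ^ length (filter all? E)) (sublists L)
    ≡⟨ expectation-^ all? q 1ℚ L ⟩
  (1ℚ - q + q * 1ℚ) ^ length (filter all? L)
    ≡⟨ cong (_^ length (filter all? L)) (solve 1 (λ q → con 1ℚ :- q :+ q :* con 1ℚ := con 1ℚ) refl q) ⟩
  1ℚ ^ length (filter all? L)
    ≡⟨ 1^n≡1 (length (filter all? L)) ⟩
  1ℚ ∎
  where
  open ≡-Reasoning
  w : List A → ℚ
  w E = bernoulliWeight q (length L) (length E)
  all? : Decidable {A = A} (λ _ → ⊤)
  all? _ = yes tt
  1^n≡1 : ∀ n → 1ℚ ^ n ≡ 1ℚ
  1^n≡1 zero    = refl
  1^n≡1 (suc n) = trans (*-identityˡ _) (1^n≡1 n)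

2^*½^ : ∀ n → ι (2 ℕ.^ n) * ½ ^ n ≡ 1ℚ
2^*½^ zero    = refl
2^*½^ (suc n) = begin
  ι (2 ℕ.* 2 ℕ.^ n) * (½ * ½ ^ n)      ≡⟨ cong (_* (½ * ½ ^ n)) (ι-* 2 (2 ℕ.^ n)) ⟩
  ι 2 * ι (2 ℕ.^ n) * (½ * ½ ^ n)      ≡⟨ solve 2 (λ a b → con (ι 2) :* a :* (con ½ :* b) := a :* b) refl (ι (2 ℕ.^ n)) (½ ^ n) ⟩
  ι (2 ℕ.^ n) * ½ ^ n                  ≡⟨ 2^*½^ n ⟩
  1ℚ ∎
  where open ≡-Reasoning

-- Decay of the error term

-- Division-free form of (1 - h)ᵏ ≤ 1 / (1 + k h). The induction rests on (1 + (k + 1) h)(1 - h) = 1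
-- + k h - (k + 1) h².
bernoulli : ∀ {h} → 0ℚ ≤ h → h ≤ 1ℚ → ∀ k → (1ℚ + ι k * h) * (1ℚ - h) ^ k ≤ 1ℚ
bernoulli {h} 0≤h h≤1 zero    = ≤-reflexive (solve 1 (λ h → (con 1ℚ :+ con 0ℚ :* h) :* con 1ℚ := con 1ℚ) refl h)
bernoulli {h} 0≤h h≤1 (suc k) = begin
  (1ℚ + ι (suc k) * h) * ((1ℚ - h) * R)
    ≤⟨ p≤p+q (0≤* (0≤* (0≤ι (suc k)) (0≤* 0≤h 0≤h)) (0≤^ k (p≤q⇒0≤q-p h≤1))) ⟩
  (1ℚ + ι (suc k) * h) * ((1ℚ - h) * R) + ι (suc k) * (h * h) * R
    ≡⟨ solve 3 (λ K h R → (con 1ℚ :+ (con 1ℚ :+ K) :* h) :* ((con 1ℚ :- h) :* R) :+ (con 1ℚ :+ K) :* (h :* h) :* R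
                          := (con 1ℚ :+ K :* h) :* R) refl (ι k) h R ⟩
  (1ℚ + ι k * h) * R
    ≤⟨ bernoulli 0≤h h≤1 k ⟩
  1ℚ ∎
  where
  open ≤-Reasoning
  R = (1ℚ - h) ^ k

quartic-identity : ∀ h K R c → h ^ 4 * K * ((K * c) * (K * c) * ((K * c) * R ^ 4)) ≡ c ^ 3 * (K * h * R) ^ 4
quartic-identity = solve 4 (λ h K R c →
  h :^ 4 :* K :* ((K :* c) :* (K :* c) :* ((K :* c) :* R :^ 4)) := c :^ 3 :* (K :* h :* R) :^ 4) refl

-- Multiplying by h⁴ K pairs each of the four factors R with a factor K h. As K h R ≤ 1, only the
-- fixed c³ is left to compare with h⁴ ε K, which grows with K.
cubic*quartic<ε : ∀ {h ε K R c B} → 0ℚ < h → 0ℚ < ε → 0ℚ < K → 0ℚ ≤ R → 0ℚ ≤ c → K * h * R ≤ 1ℚ →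
  B ≤ (K * c) * (K * c) * ((K * c) * R ^ 4) → c ^ 3 < h ^ 4 * ε * K → B < ε
cubic*quartic<ε {h} {ε} {K} {R} {c} {B} 0<h 0<ε 0<K 0≤R 0≤c KhR≤1 B≤ c³< =
  *-cancelˡ-<-nonNeg (h ^ 4 * K) {{nonNegative (<⇒≤ 0<h⁴K)}} (begin-strict
    h ^ 4 * K * B
      ≤⟨ *-monoˡ-≤ (<⇒≤ 0<h⁴K) B≤ ⟩
    h ^ 4 * K * ((K * c) * (K * c) * ((K * c) * R ^ 4))
      ≡⟨ quartic-identity h K R c ⟩
    c ^ 3 * (K * h * R) ^ 4
      ≤⟨ *-monoˡ-≤ (0≤^ 3 0≤c) (^-monoˡ-≤ 4 (0≤* (0≤* (<⇒≤ 0<K) (<⇒≤ 0<h)) 0≤R) KhR≤1) ⟩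
    c ^ 3 * 1ℚ
      ≡⟨ *-identityʳ (c ^ 3) ⟩
    c ^ 3
      <⟨ c³< ⟩
    h ^ 4 * ε * K
      ≡⟨ solve 3 (λ a e K → a :* e :* K := a :* K :* e) refl (h ^ 4) ε K ⟩
    h ^ 4 * K * ε ∎)
  where
  open ≤-Reasoning
  0<h⁴K = 0<* (0<^ 4 0<h) 0<K

-- The fourth power of k h (1 − h)ᵏ ≤ 1, with k = ⌊m/4⌋, beats the cubic factor.
decay : ∀ h ε → 0ℚ < h → h ≤ 1ℚ → 0ℚ < ε →
  ∃[ N ] ∀ m → N ℕ.≤ m → ι (suc m ℕ.* suc m) * (ι (suc m) * (1ℚ - h) ^ m) < ε
decay h ε 0<h h≤1 0<ε
  = let K₀ , 8³<aεK₀ = archimedean-* (h ^ 4 * ε) (ι 8 ^ 3) (0<* (0<^ 4 0<h) 0<ε) in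
    -- N = 4 (K₀ + 1) forces K₀ + 1 ≤ ⌊m/4⌋; the added 1 makes k positive even for K₀ = 0.
    suc K₀ ℕ.* 4 , λ m N≤m → small K₀ 8³<aεK₀ m (subst (ℕ._≤ m ℕ./ 4) (ℕ.m*n/n≡m (suc K₀) 4) (ℕ./-monoˡ-≤ 4 N≤m))
  where
  0≤h = <⇒≤ 0<h
  r = 1ℚ - h
  0≤r : 0ℚ ≤ r
  0≤r = p≤q⇒0≤q-p h≤1
  r≤1 : r ≤ 1ℚ
  r≤1 = ≤-trans (p≤p+q 0≤h) (≤-reflexive (solve 1 (λ h → con 1ℚ :- h :+ h := con 1ℚ) refl h))
  module _ (K₀ : ℕ) (8³<aεK₀ : ι 8 ^ 3 < h ^ 4 * ε * ι K₀) (m : ℕ) (K₀<k : suc K₀ ℕ.≤ m ℕ./ 4) where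
    open ≤-Reasoning
    k = m ℕ./ 4
    K = ι k
    R = r ^ k
    0≤R = 0≤^ k 0≤r
    B = ι (suc m ℕ.* suc m) * (ι (suc m) * r ^ m)

    KhR≤1 : K * h * R ≤ 1ℚ
    KhR≤1 = ≤-trans (*-monoʳ-≤ 0≤R (p≤q+p {K * h} 0≤1)) (bernoulli 0≤h h≤1 k)

    -- The origin of the constant 8: m + 1 = (m mod 4 + 1) + 4k ≤ 4 + 4k ≤ 8k, as k is positive.
    1+m≤k*8 : suc m ℕ.≤ k ℕ.* 8
    1+m≤k*8 = ℕ.≤-trans (ℕ.≤-reflexive (cong suc (ℕ.m≡m%n+[m/n]*n m 4)))
      (ℕ.≤-trans (ℕ.+-monoˡ-≤ (k ℕ.* 4) (ℕ.≤-trans (ℕ.m%n<n m 4) (ℕ.*-monoˡ-≤ 4 (ℕ.≤-trans (ℕ.s≤s ℕ.z≤n) K₀<k))))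
                 (ℕ.≤-reflexive (sym (ℕ.*-distribˡ-+ k 4 4))))

    ι[1+m]≤8K : ι (suc m) ≤ K * ι 8
    ι[1+m]≤8K = ≤-trans (ι-mono-≤ 1+m≤k*8) (≤-reflexive (ι-* k 8))

    0≤8K : 0ℚ ≤ K * ι 8
    0≤8K = 0≤* (0≤ι k) (0≤ι 8)

    r^m≤R^4 : r ^ m ≤ R ^ 4
    r^m≤R^4 = ≤-trans (^-antimonoʳ-≤ 0≤r r≤1 (ℕ.m/n*n≤m m 4)) (≤-reflexive (sym (^-assocʳ r k 4)))

    B≤ : B ≤ (K * ι 8) * (K * ι 8) * ((K * ι 8) * R ^ 4)
    B≤ = *-mono-≤ (0≤* 0≤8K 0≤8K) (0≤* (0≤ι (suc m)) (0≤^ m 0≤r))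
      (≤-trans (≤-reflexive (ι-* (suc m) (suc m))) (*-mono-≤ 0≤8K (0≤ι (suc m)) ι[1+m]≤8K ι[1+m]≤8K))
      (*-mono-≤ 0≤8K (0≤^ m 0≤r) ι[1+m]≤8K r^m≤R^4)

    0<K : 0ℚ < K
    0<K = <-≤-trans (positive⁻¹ 1ℚ) (≤-trans (p≤p+q (0≤ι K₀)) (ι-mono-≤ K₀<k))

    small : B < ε
    small = cubic*quartic<ε 0<h 0<ε 0<K 0≤R (0≤ι 8) KhR≤1 B≤ (<-≤-trans 8³<aεK₀
      (*-monoˡ-≤ (<⇒≤ (0<* (0<^ 4 0<h) 0<ε)) (ι-mono-≤ (ℕ.≤-trans (ℕ.n≤1+n K₀) K₀<k))))

-- The probability of unimodality

seq-^ : ∀ x m k → seq (x ^ℝ m) k ≡ seq x k ^ m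
seq-^ x zero    k = refl
seq-^ x (suc m) k = cong (seq x k *_) (seq-^ x m k)

edgeSetWeight : {A : Set} → ℚ → List A → List A → ℚ
edgeSetWeight q L E = bernoulliWeight q (length L) (length E)

probability : {A : Set} {Good : List A → Set} → ℚ → List A → Decidable Good → ℚ
probability q L Good? = Σℚ (edgeSetWeight q L) (filter Good? (sublists L))

module _ {A : Set} {Good : List A → Set} (L : List A) (Good? : Decidable Good)
         {q : ℚ} (0≤q : 0ℚ ≤ q) (q≤1 : q ≤ 1ℚ) where

  private
    Es = sublists L
    w  = edgeSetWeight q L
    0≤w : ∀ E → 0ℚ ≤ w E
    0≤w E = 0≤bernoulliWeight 0≤q q≤1 (length L) (length E)
    0≤½ : 0ℚ ≤ ½
    0≤½ = nonNegative⁻¹ ½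

  probability≤1 : probability q L Good? ≤ 1ℚ
  probability≤1 = ≤-trans (Σℚ-filter≤ Good? 0≤w Es) (≤-reflexive (sum-bernoulliWeight q L))

  module _ {B : Set} {Inc : B → A → Set} (inc? : ∀ u → Decidable (Inc u)) (us : List B) (N : ℕ) where

    private
      d : B → List A → ℕ
      d u E = length (filter (inc? u) E)
      S X : List A → ℚ
      S E = Σℚ (λ u → ½ ^ d u E) us
      X E = ι N * S E

    -- Linearity of expectation, after exchanging the sums over edge sets and over `us`; each inner
    -- sum is `expectation-^` at s = ½.
    expected-sum : Σℚ (λ E → w E * X E) Es ≡ ι N * Σℚ (λ u → (1ℚ - q + q * ½) ^ d u L) us
    expected-sum = begin
      Σℚ (λ E → w E * X E) Es
        ≡⟨ Σℚ-cong Es (λ {E} _ → trans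
             (solve 3 (λ w c s → w :* (c :* s) := c :* (w :* s)) refl (w E) (ι N) (S E))
             (cong (ι N *_) (sym (Σℚ-*ˡ (w E) (λ u → ½ ^ d u E) us)))) ⟩
      Σℚ (λ E → ι N * Σℚ (λ u → w E * ½ ^ d u E) us) Es
        ≡⟨ Σℚ-*ˡ (ι N) (λ E → Σℚ (λ u → w E * ½ ^ d u E) us) Es ⟩
      ι N * Σℚ (λ E → Σℚ (λ u → w E * ½ ^ d u E) us) Es
        ≡⟨ cong (ι N *_) (Σℚ-swap (λ E u → w E * ½ ^ d u E) Es us) ⟩
      ι N * Σℚ (λ u → Σℚ (λ E → w E * ½ ^ d u E) Es) us
        ≡⟨ cong (ι N *_) (Σℚ-cong us λ {u} _ → expectation-^ (inc? u) q ½ L) ⟩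
      ι N * Σℚ (λ u → (1ℚ - q + q * ½) ^ d u L) us ∎
      where open ≡-Reasoning

    module _ (bad : ∀ {E} → E List.∈ Es → ¬ Good E → ∃[ u ] u List.∈ us × 2 ℕ.^ d u E ℕ.< N)
             {m : ℕ} (m≤d : ∀ u → m ℕ.≤ d u L) {δ : ℚ} (0≤δ : 0ℚ ≤ δ) (δ≤q : δ ≤ q) where

      private
        open ≤-Reasoning

        0≤X : ∀ E → 0ℚ ≤ X E
        0≤X E = 0≤* (0≤ι N) (0≤Σℚ (λ u → 0≤^ (d u E) 0≤½) us)

        1≤X : ∀ {E} → E List.∈ Es → ¬ Good E → 1ℚ ≤ X E
        1≤X {E} E∈ ¬good = let u , u∈ , 2^d<N = bad E∈ ¬good in begin
          1ℚ                               ≡⟨ 2^*½^ (d u E) ⟨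
          ι (2 ℕ.^ d u E) * ½ ^ d u E      ≤⟨ *-mono-≤ (0≤ι N) (0≤^ (d u E) 0≤½) (ι-mono-≤ (ℕ.<⇒≤ 2^d<N))
                                                (∈⇒≤Σℚ (λ u → 0≤^ (d u E) 0≤½) u∈) ⟩
          X E ∎

        base = 1ℚ - q + q * ½
        -- `base` equals 1 - q/2; putting δ for q makes the bound the same for every approximation q
        -- ≥ δ.
        r    = 1ℚ - δ * ½

        base≤r : base ≤ r
        base≤r = begin
          1ℚ - q + q * ½    ≡⟨ solve 1 (λ q → con 1ℚ :- q :+ q :* con ½ := con 1ℚ :- q :* con ½) refl q ⟩
          1ℚ - q * ½        ≤⟨ +-monoʳ-≤ 1ℚ (neg-antimono-≤ (*-monoʳ-≤ 0≤½ δ≤q)) ⟩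
          1ℚ - δ * ½ ∎

        0≤base : 0ℚ ≤ base
        0≤base = 0≤+ (p≤q⇒0≤q-p q≤1) (0≤* 0≤q 0≤½)

        r≤1 : r ≤ 1ℚ
        r≤1 = ≤-trans (p≤p+q {r} (0≤* 0≤δ 0≤½)) (≤-reflexive (solve 1 (λ x → con 1ℚ :- x :+ x := con 1ℚ) refl (δ * ½)))

        base^d≤r^m : ∀ u → base ^ d u L ≤ r ^ m
        base^d≤r^m u = ≤-trans (^-monoˡ-≤ (d u L) 0≤base base≤r) (^-antimonoʳ-≤ (≤-trans 0≤base base≤r) r≤1 (m≤d u))

      1≤probability+ : 1ℚ ≤ probability q L Good? + ι N * (ι (length us) * (1ℚ - δ * ½) ^ m)
      1≤probability+ = begin
        1ℚ                                                    ≡⟨ sum-bernoulliWeight q L ⟨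
        Σℚ w Es                                               ≤⟨ markov Good? 0≤w 0≤X Es 1≤X ⟩
        probability q L Good? + Σℚ (λ E → w E * X E) Es       ≡⟨ cong (probability q L Good? +_) expected-sum ⟩
        probability q L Good? + ι N * Σℚ (λ u → base ^ d u L) us
          ≤⟨ +-monoʳ-≤ (probability q L Good?) (*-monoˡ-≤ (0≤ι N) (Σℚ≤length* base^d≤r^m us)) ⟩
        probability q L Good? + ι N * (ι (length us) * r ^ m) ∎

-- The error bound for random graphs and the limit

unimodal? : ∀ {n} → Decidable (DominationUnimodalWithMode ⌈ n /2⌉ ∘ fromEdges {n})
unimodal? {n} E = dominationUnimodalWithMode? ⌈ n /2⌉ (fromEdges E)

unimodalProbability : ∀ n → ℚ → ℚ
unimodalProbability n q = probability q (potentialEdges n) unimodal?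

-- Real operations act termwise on sequences, so the k-th term of a probability is itself the
-- probability for the rational parameter `seq p k`.
seq-sum : ∀ n p k xs →
  seq (sumℝ (map (edgeSetProbability n p) xs)) k ≡ Σℚ (edgeSetWeight (seq p k) (potentialEdges n)) xs
seq-sum n p k []       = refl
seq-sum n p k (E ∷ xs) = cong₂ _+_
  (cong₂ _*_ (seq-^ p (length E) k) (seq-^ (1ℝ -ℝ p) (length (potentialEdges n) ℕ.∸ length E) k))
  (seq-sum n p k xs)

module _ {q δ : ℚ} (0≤q : 0ℚ ≤ q) (q≤1 : q ≤ 1ℚ) (0≤δ : 0ℚ ≤ δ) (δ≤q : δ ≤ q) (m : ℕ) where

  1≤unimodalProbability+ :
    1ℚ ≤ unimodalProbability (suc m) q + ι (suc m ℕ.* suc m) * (ι (suc m) * (1ℚ - δ * ½) ^ m)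
  1≤unimodalProbability+ =
    subst (λ l → 1ℚ ≤ unimodalProbability (suc m) q + ι (suc m ℕ.* suc m) * (ι l * (1ℚ - δ * ½) ^ m))
      (List.length-tabulate {n = suc m} (λ x → x))
      (1≤probability+ (potentialEdges (suc m)) unimodal? 0≤q q≤1 incident? (allFin (suc m)) (suc m ℕ.* suc m)
        (λ E∈ ¬uni → let u , 2^d<n² = ¬unimodal⇒small-degree E∈ ¬uni in u , ∈-allFin u , 2^d<n²)
        degree-potentialEdges 0≤δ δ≤q)

-- One half of η bounds the error `B`; the other half is the gap that `_<ℝ_` demands.
1-ε+η½<U : ∀ {ε η U B} → η < ε → 1ℚ ≤ U + B → B < η * ½ → 1ℚ - ε + η * ½ < U
1-ε+η½<U {ε} {η} {U} {B} η<ε 1≤U+B B<η½ = begin-strict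
  1ℚ - ε + η * ½        <⟨ +-monoˡ-< (η * ½) (+-monoʳ-< 1ℚ (neg-antimono-< η<ε)) ⟩
  1ℚ - η + η * ½        ≡⟨ solve 1 (λ η → con 1ℚ :- η :+ η :* con ½ := con 1ℚ :- η :* con ½) refl η ⟩
  1ℚ - η * ½            ≤⟨ +-monoˡ-≤ (- (η * ½)) 1≤U+B ⟩
  U + B - η * ½         <⟨ +-monoˡ-< (- (η * ½)) (+-monoʳ-< U B<η½) ⟩
  U + η * ½ - η * ½     ≡⟨ solve 2 (λ u e → u :+ e :- e := u) refl U (η * ½) ⟩
  U ∎
  where open ≤-Reasoning

U+η½<1+ε : ∀ {ε η U} → 0ℚ ≤ η → η < ε → U ≤ 1ℚ → U + η * ½ < 1ℚ + ε
U+η½<1+ε {ε} {η} {U} 0≤η η<ε U≤1 = begin-strict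
  U + η * ½     ≤⟨ +-mono-≤ U≤1 (≤-trans (p≤p+q (0≤* 0≤η (nonNegative⁻¹ ½)))
                     (≤-reflexive (solve 1 (λ η → η :* con ½ :+ η :* con ½ := η) refl η))) ⟩
  1ℚ + η        <⟨ +-monoʳ-< 1ℚ η<ε ⟩
  1ℚ + ε ∎
  where open ≤-Reasoning

theorem3p3 : (p : ℝ) → 0ℝ <ℝ p → p <ℝ 1ℝ →
    (λ n → Pr[𝒢 n , p ] (dominationUnimodalWithMode? ⌈ n /2⌉)) TendsTo 1ℝ
theorem3p3 p (δ , 0<δ , N₀ , δ<p) (δ′ , 0<δ′ , N₁ , p<1) ε (η , 0<η , N₂ , η<ε)
  = let N , small = decay (δ * ½) (η * ½) (0<* 0<δ (positive⁻¹ ½)) δ½≤1 0<η½ in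
    -- The threshold N + 1 rules out n = 0, so n = m + 1 and m potential edges are available at each
    -- vertex. N depends on δ and η alone, not on the index k.
    suc N , λ { zero () ; (suc m) (ℕ.s≤s N≤m) →
      (η * ½ , 0<η½ , M , λ k M≤k → lower m (small m N≤m) k M≤k)
    , (η * ½ , 0<η½ , M , upper m) }
  where
  M = N₀ ℕ.⊔ N₁ ℕ.⊔ N₂
  0<η½ = 0<* 0<η (positive⁻¹ ½)
  module _ (k : ℕ) (M≤k : M ℕ.≤ k) where
    q = seq p k
    δ<q : δ < q
    δ<q = subst (_< q) (+-identityˡ δ) (δ<p k (ℕ.≤-trans (ℕ.≤-trans (ℕ.m≤m⊔n N₀ N₁) (ℕ.m≤m⊔n _ N₂)) M≤k))
    0≤q : 0ℚ ≤ q
    0≤q = <⇒≤ (<-trans 0<δ δ<q)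
    q≤1 : q ≤ 1ℚ
    q≤1 = ≤-trans (p≤p+q (<⇒≤ 0<δ′)) (<⇒≤ (p<1 k (ℕ.≤-trans (ℕ.≤-trans (ℕ.m≤n⊔m N₀ N₁) (ℕ.m≤m⊔n _ N₂)) M≤k)))
    η<εₖ : η < seq ε k
    η<εₖ = subst (_< seq ε k) (+-identityˡ η) (η<ε k (ℕ.≤-trans (ℕ.m≤n⊔m (N₀ ℕ.⊔ N₁) N₂) M≤k))
  δ½≤1 : δ * ½ ≤ 1ℚ
  -- A single late index suffices: at `M`, δ < q ≤ 1.
  δ½≤1 = *-mono-≤ 0≤1 (nonNegative⁻¹ ½) (≤-trans (<⇒≤ (δ<q M ℕ.≤-refl)) (q≤1 M ℕ.≤-refl)) ½≤1
    where
    ½≤1 : ½ ≤ 1ℚ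
    ½≤1 = p≤p+q (nonNegative⁻¹ ½)
  Pr : ∀ n k → seq (Pr[𝒢 n , p ] (dominationUnimodalWithMode? ⌈ n /2⌉)) k ≡ unimodalProbability n (seq p k)
  Pr n k = seq-sum n p k (filter (unimodal? {n}) (sublists (potentialEdges n)))
  lower : ∀ m → ι (suc m ℕ.* suc m) * (ι (suc m) * (1ℚ - δ * ½) ^ m) < η * ½ → ∀ k → M ℕ.≤ k →
    1ℚ - seq ε k + η * ½ < seq (Pr[𝒢 suc m , p ] (dominationUnimodalWithMode? ⌈ suc m /2⌉)) k
  lower m small k M≤k = subst (1ℚ - seq ε k + η * ½ <_) (sym (Pr (suc m) k))
    (1-ε+η½<U (η<εₖ k M≤k) (1≤unimodalProbability+ (0≤q k M≤k) (q≤1 k M≤k) (<⇒≤ 0<δ) (<⇒≤ (δ<q k M≤k)) m) small)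
  upper : ∀ m k → M ℕ.≤ k →
    seq (Pr[𝒢 suc m , p ] (dominationUnimodalWithMode? ⌈ suc m /2⌉)) k + η * ½ < 1ℚ + seq ε k
  upper m k M≤k = subst (λ U → U + η * ½ < 1ℚ + seq ε k) (sym (Pr (suc m) k))
    (U+η½<1+ε (<⇒≤ 0<η) (η<εₖ k M≤k) (probability≤1 (potentialEdges (suc m)) unimodal? (0≤q k M≤k) (q≤1 k M≤k)))
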